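{- There is a computable age $\mathbb K$, which is the canonical computable age of some (computable) structure in a finite relational language, such that $\mathbb K$ has the cofinal amalgamation property (CAP) but, for every Turing degree $\mathfrak s$, if $\mathbb K$ has the $\mathfrak s$-computable cofinal amalgamation property $\mathfrak s$-(cCAP), then $\mathbf{0'}\leq_{\mathrm T}\mathfrak s$.
   Context: Languages and structures. $\mathcal{L}$ is a countable language with a computable representation: relation symbols $R_n$ (of positive arity) and function symbols $F_m$ are indexed bijectively by disjoint computable subsets of $\omega$, with arity computable from the index. An $\mathcal{L}$-structure $\mathcal{M}$ is c.e. if its underlying set $M$ is a c.e. subset of $\omega$ and the sets $\{(n,\mathbf a): \mathcal M\models R_n(\mathbf a)\}$, $\{(n,\mathbf a): \mathcal M\models \neg R_n(\mathbf a)\}$, $\{(m,\mathbf a,b): \mathcal M\models F_m(\mathbf a)=b\}$ are c.e.; it is computable if moreover $M$ is computable. Tuples are finite; $\mathrm{cl}_{\mathcal M}(\mathbf a)$ is the smallest substructure of $\mathcal M$ containing $\mathbf a$. For $\mathbf a\in\mathcal A$, $\mathbf b\in\mathcal B$ of the same length, $\mathbf a\simeq\mathbf b$ means that for every atomic $\mathcal L$-formula $\varphi$, $\mathcal A\models\varphi(\mathbf a)$ iff $\mathcal B\models\varphi(\mathbf b)$; equivalently $\mathbf a\mapsto\mathbf b$ extends to an isomorphism $\mathrm{cl}(\mathbf a)\to\mathrm{cl}(\mathbf b)$. $\mathbf{0'}$ is the Turing jump of the least Turing degree. Ages. An age is a collection of finitely generated $\mathcal L$-structures closed under isomorphism. A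 computable age (computable representation of an age $\mathcal K$) is a c.e. set $\mathbb K$ of triples $(\mathbf a,\mathcal A,i)$ (computable structures being given by indices), with exactly one triple for each $i\in\omega$, written $\mathbb I(i)=(\mathbf a_i,\mathcal A_i,i)$, such that each $\mathcal A_i$ is a computable $\mathcal L$-structure in $\mathcal K$ with $\mathcal A_i=\mathrm{cl}_{\mathcal A_i}(\mathbf a_i)$, and every $\mathcal B\in\mathcal K$ is isomorphic to some $\mathcal A_i$. $\mathbb K$ is said to have a property of ages if $\mathcal K$ does. For a computable structure $\mathcal M$, a canonical computable age of $\mathcal M$ is the sequence $(\mathbf a_i,\mathrm{cl}_{\mathcal M}(\mathbf a_i),i)_{i\in\omega}$, where $(\mathbf a_i)_{i\in\omega}$ is a computable enumeration of all finite tuples in $\mathcal M$ in which every tuple appears infinitely often (any two are computably isomorphic); it represents the age of $\mathcal M$, i.e. the collection of structures isomorphic to a finitely generated substructure of $\mathcal M$. Embeddings and amalgamation diagrams. A potential embedding in $\mathbb K$ is a triple $F=(\mathbb I(i),\mathbb I(j),\mathbf c)$ with $\mathbf c\in\mathcal A_j$; $\mathrm{dom}(F)=\mathbb I(i)$, $\mathrm{codom}(F)=\mathbb I(j)$. It is an embedding if $\mathbf a_i\simeq\mathbf c$ (it then encodes the embedding $\mathcal A_i\to\mathcal A_j$ sending $\mathbf a_i$ to $\mathbf c$); composition of embeddings is composition of the encoded maps, and an isomorphism is an embedding whose encoded map is onto. A potential span is a pair $(F_0,F_1)$ of potential embeddings with $\mathrm{dom}(F_0)=\mathrm{dom}(F_1)$;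 it is a span if both are embeddings. An amalgamation diagram over a potential span $(F_0,F_1)$ is a pair $(G_0,G_1)$ with $G_0$ an embedding, $G_1$ a potential embedding, $\mathrm{dom}(G_i)=\mathrm{codom}(F_i)$ for $i\in\{0,1\}$, $\mathrm{codom}(G_0)=\mathrm{codom}(G_1)$, and such that if $(F_0,F_1)$ is a span then $G_1$ is an embedding and $G_0\circ F_0=G_1\circ F_1$. Cofinal amalgamation. An amalgamation base is an $\mathcal A'\in\mathcal K$ such that whenever $\mathcal B,\mathcal C\in\mathcal K$ and $f_{\mathcal B}:\mathcal A'\to\mathcal B$, $f_{\mathcal C}:\mathcal A'\to\mathcal C$ are embeddings, there are $\mathcal D\in\mathcal K$ and embeddings $\alpha_{\mathcal B}:\mathcal B\to\mathcal D$, $\alpha_{\mathcal C}:\mathcal C\to\mathcal D$ with $\alpha_{\mathcal B}\circ f_{\mathcal B}=\alpha_{\mathcal C}\circ f_{\mathcal C}$. (CAP): every $\mathcal A\in\mathcal K$ embeds into some amalgamation base in $\mathcal K$. A collection of distinguished extensions is a collection of embeddings in $\mathbb K$ closed under pre- and post-composition with isomorphisms between elements of $\mathbb K$ and such that every $\mathbb I(i)$ is the domain of some member. A witness to (CAP) is a pair $(\mathrm{AB},f)$ where $\mathrm{AB}$ is a collection of distinguished extensions each of whose members has an amalgamation base as codomain, and $f$ takes each tuple $(F,G_0,G_1)$ with $F\in\mathrm{AB}$, $(G_0,G_1)$ a potential span and $\mathrm{dom}(G_0)=\mathrm{dom}(G_1)=\mathrm{codom}(F)$ to an amalgamation diagram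 over $(G_0,G_1)$. It is $\mathfrak s$-computable if $\mathrm{AB}$ is $\mathfrak s$-c.e. and $f$ is an $\mathfrak s$-computable partial function. $\mathbb K$ has $\mathfrak s$-(cCAP) if it has an $\mathfrak s$-computable witness to (CAP). -}

module Defs where

open import Data.Fin using (Fin; cast)
open import Data.List using (List; []; _∷_; length; lookup; map)
open import Data.List.Membership.Propositional using () renaming (_∈_ to _∈ˡ_)
open import Data.List.Membership.Propositional.Properties using (∈-map⁺)
open import Data.List.Properties using (map-∘)
open import Data.List.Relation.Unary.All using (All)
open import Data.List.Relation.Unary.All.Properties using () renaming (map⁺ to All-map⁺)
import Data.List.Relation.Unary.All as ListAll
open import Data.Nat using (ℕ; zero; suc; _+_; _<_; _≤_)
open import Data.Product using (∃; ∃-syntax; Σ-syntax; _×_; _,_)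
open import Data.Vec using (Vec; []; _∷_; toList)
import Data.Vec as Vec
import Data.Vec.Properties as VecProp
open import Data.Vec.Relation.Unary.All using ([]; _∷_) renaming (All to Allᵛ)
import Data.Vec.Relation.Unary.All as VecAll
open import Data.Vec.Relation.Unary.All.Properties using () renaming (map⁺ to Allᵛ-map⁺)
open import Function using (_∘_; _⇔_; mk⇔; Equivalence)
open import Level using (0ℓ)
open import Relation.Binary.PropositionalEquality using (_≡_; refl; sym; trans; cong; subst)
open import Relation.Nullary using (¬_)
open import Relation.Unary using (Pred; _∈_; ∅)

triangle : ℕ → ℕ
triangle zero    = zero
triangle (suc n) = suc n + triangle n

-- The Cantor pairing bijection ℕ × ℕ → ℕ.
⟪_,_⟫ : ℕ → ℕ → ℕ
⟪ m , n ⟫ = triangle (m + n) + n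

⌜_⌝ : List ℕ → ℕ
⌜ [] ⌝     = zero
⌜ x ∷ xs ⌝ = suc ⟪ x , ⌜ xs ⌝ ⟫

-- Programs for the unary partial recursive functions with an oracle.
data Code : Set where
  zeroᶜ succᶜ leftᶜ rightᶜ oracleᶜ : Code
  pairᶜ compᶜ precᶜ : Code → Code → Code
  muᶜ : Code → Code

-- Eval S c n m: with oracle S, the program c halts on input n with output m.
data Eval (S : Pred ℕ 0ℓ) : Code → ℕ → ℕ → Set where
  e-zero  : ∀ {n} → Eval S zeroᶜ n 0
  e-succ  : ∀ {n} → Eval S succᶜ n (suc n)
  e-left  : ∀ {m n} → Eval S leftᶜ ⟪ m , n ⟫ m
  e-right : ∀ {m n} → Eval S rightᶜ ⟪ m , n ⟫ n
  e-yes   : ∀ {n} → n ∈ S → Eval S oracleᶜ n 1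
  e-no    : ∀ {n} → ¬ (n ∈ S) → Eval S oracleᶜ n 0
  e-pair  : ∀ {c d n x y} → Eval S c n x → Eval S d n y →
            Eval S (pairᶜ c d) n ⟪ x , y ⟫
  e-comp  : ∀ {c d n x y} → Eval S d n x → Eval S c x y →
            Eval S (compᶜ c d) n y
  e-prec₀ : ∀ {c d n x} → Eval S c n x → Eval S (precᶜ c d) ⟪ n , 0 ⟫ x
  e-precₛ : ∀ {c d n k x y} → Eval S (precᶜ c d) ⟪ n , k ⟫ x →
            Eval S d ⟪ n , ⟪ k , x ⟫ ⟫ y →
            Eval S (precᶜ c d) ⟪ n , suc k ⟫ y
  e-mu    : ∀ {c n k} → Eval S c ⟪ n , k ⟫ 0 →
            (∀ j → j < k → ∃ λ v → Eval S c ⟪ n , j ⟫ (suc v)) →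
            Eval S (muᶜ c) n k

gödel : Code → ℕ
gödel zeroᶜ       = ⟪ 0 , 0 ⟫
gödel succᶜ       = ⟪ 1 , 0 ⟫
gödel leftᶜ       = ⟪ 2 , 0 ⟫
gödel rightᶜ      = ⟪ 3 , 0 ⟫
gödel oracleᶜ     = ⟪ 4 , 0 ⟫
gödel (pairᶜ c d) = ⟪ 5 , ⟪ gödel c , gödel d ⟫ ⟫
gödel (compᶜ c d) = ⟪ 6 , ⟪ gödel c , gödel d ⟫ ⟫
gödel (precᶜ c d) = ⟪ 7 , ⟪ gödel c , gödel d ⟫ ⟫
gödel (muᶜ c)     = ⟪ 8 , gödel c ⟫

-- φ S e n m: the partial S-computable function with index e sends n to m.
-- An e that is not the Gödel number of a program is an index of the
-- nowhere defined function.
φ : Pred ℕ 0ℓ → ℕ → ℕ → ℕ → Set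
φ S e n m = ∃[ c ] gödel c ≡ e × Eval S c n m

EnumeratedBy : Pred ℕ 0ℓ → ℕ → Pred ℕ 0ℓ → Set
EnumeratedBy S e P = ∀ n → n ∈ P ⇔ ∃ (φ S e n)

DecidedBy : Pred ℕ 0ℓ → ℕ → Pred ℕ 0ℓ → Set
DecidedBy S e P = ∀ n → (n ∈ P → φ S e n 1) × (¬ (n ∈ P) → φ S e n 0)

CE-in : Pred ℕ 0ℓ → Pred ℕ 0ℓ → Set
CE-in S P = ∃[ e ] EnumeratedBy S e P

-- Turing degrees are represented by their members: a property of the degree
-- of S is stated for the set S.
_≤ᵀ_ : Pred ℕ 0ℓ → Pred ℕ 0ℓ → Set
P ≤ᵀ S = ∃[ e ] DecidedBy S e P

jump : Pred ℕ 0ℓ → Pred ℕ 0ℓ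
jump S e = ∃ (φ S e e)

∅′ : Pred ℕ 0ℓ
∅′ = jump ∅

-- Without a qualifier, "c.e." and "computable" mean relative to ∅.
CE Computable : Pred ℕ 0ℓ → Set
CE P         = CE-in ∅ P
Computable P = P ≤ᵀ ∅

ComputableFun : (ℕ → ℕ) → Set
ComputableFun f = ∃[ e ] (∀ n → φ ∅ e n (f n))

-- Symbols are identified with their indices; the value of arity at a number
-- that is not the index of a symbol is irrelevant.
record Language : Set₁ where
  field
    RelSym FunSym  : Pred ℕ 0ℓ
    arity          : ℕ → ℕ
    disjoint       : ∀ {n} → n ∈ RelSym → ¬ (n ∈ FunSym)
    positive       : ∀ {n} → n ∈ RelSym → 0 < arity n
    RelSym-comp    : Computable RelSym
    FunSym-comp    : Computable FunSym
    arity-comp     : ComputableFun arity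

FiniteRelational : Language → Set
FiniteRelational L = (∃[ ns ] (∀ {n} → n ∈ RelSym → n ∈ˡ ns)) × (∀ {n} → ¬ (n ∈ FunSym))
  where open Language L

-- Underlying sets are subsets of ω, which up to isomorphism is no restriction
-- for finitely generated structures in a countable language.  The values of
-- rel and fun at numbers that are not symbols, and at tuples not contained in
-- dom, are irrelevant.
record Structure (L : Language) : Set₁ where
  open Language L
  field
    dom    : Pred ℕ 0ℓ
    rel    : ∀ n → Vec ℕ (arity n) → Set
    fun    : ∀ m → Vec ℕ (arity m) → ℕ
    closed : ∀ {m} → m ∈ FunSym → ∀ {v} → Allᵛ dom v → fun m v ∈ dom

open Structure public

module _ {L : Language} where
  open Language L

  record _≐_ (A B : Structure L) : Set where
    field
      dom-≐ : ∀ x → x ∈ dom A ⇔ x ∈ dom B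
      rel-≐ : ∀ {n} → n ∈ RelSym → ∀ {v} → Allᵛ (dom A) v → rel A n v ⇔ rel B n v
      fun-≐ : ∀ {m} → m ∈ FunSym → ∀ {v} → Allᵛ (dom A) v → fun A m v ≡ fun B m v

  -- The underlying set of the substructure generated by the tuple a.
  data Gen (M : Structure L) (a : List ℕ) : ℕ → Set where
    gen : ∀ {x} → x ∈ˡ a → Gen M a x
    app : ∀ {m} → m ∈ FunSym → ∀ {v} → Allᵛ (Gen M a) v → Gen M a (fun M m v)

  cl : Structure L → List ℕ → Structure L
  cl M a = record { dom = Gen M a ; rel = rel M ; fun = fun M ; closed = app }

  FinitelyGenerated : Structure L → Set
  FinitelyGenerated A = ∃[ a ] All (dom A) a × (∀ {x} → x ∈ dom A → x ∈ Gen A a)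

  -- The values of map-of outside dom A are irrelevant.
  record _↪_ (A B : Structure L) : Set where
    field
      map-of    : ℕ → ℕ
      into      : ∀ {x} → x ∈ dom A → map-of x ∈ dom B
      injective : ∀ {x y} → x ∈ dom A → y ∈ dom A → map-of x ≡ map-of y → x ≡ y
      rel-⇔     : ∀ {n} → n ∈ RelSym → ∀ {v} → Allᵛ (dom A) v →
                  rel A n v ⇔ rel B n (Vec.map map-of v)
      fun-≡     : ∀ {m} → m ∈ FunSym → ∀ {v} → Allᵛ (dom A) v →
                  map-of (fun A m v) ≡ fun B m (Vec.map map-of v)

  open _↪_ public

  Onto : {A B : Structure L} → A ↪ B → Set
  Onto {A} {B} f = ∀ {y} → y ∈ dom B → ∃[ x ] x ∈ dom A × map-of f x ≡ y

  _≅_ : Structure L → Structure L → Set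
  A ≅ B = Σ[ f ∈ A ↪ B ] Onto f

  data Term (k : ℕ) : Set where
    var : Fin k → Term k
    app : ∀ {m} → m ∈ FunSym → Vec (Term k) (arity m) → Term k

  data Atomic (k : ℕ) : Set where
    _≈_  : Term k → Term k → Atomic k
    atom : ∀ {n} → n ∈ RelSym → Vec (Term k) (arity n) → Atomic k

  module _ (A : Structure L) {k : ℕ} (ρ : Fin k → ℕ) where
    mutual
      value : Term k → ℕ
      value (var i)            = ρ i
      value (app {m = m} _ ts) = fun A m (values ts)

      values : ∀ {l} → Vec (Term k) l → Vec ℕ l
      values []       = []
      values (t ∷ ts) = value t ∷ values ts

    _⊨_ : Atomic k → Set
    _⊨_ (s ≈ t)             = value s ≡ value t
    _⊨_ (atom {n = n} _ ts) = rel A n (values ts)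

  record _,_≃_,_ (A : Structure L) (a : List ℕ) (B : Structure L) (b : List ℕ) : Set where
    field
      same-length : length a ≡ length b
      same-atomic : (θ : Atomic (length a)) →
                    (A ⊨ lookup a) θ ⇔ (B ⊨ (lookup b ∘ cast same-length)) θ

  -- An index of a computable structure consists of an index deciding its
  -- underlying set and indices enumerating the atomic diagram.
  IsIndex : ℕ → Structure L → Set
  IsIndex e A = ∃[ d ] ∃[ p ] ∃[ q ] ∃[ g ]
      e ≡ ⟪ d , ⟪ p , ⟪ q , g ⟫ ⟫ ⟫
    × DecidedBy ∅ d (dom A)
    × EnumeratedBy ∅ p (λ x → ∃[ n ] Σ[ v ∈ Vec ℕ (arity n) ]
        n ∈ RelSym × Allᵛ (dom A) v × rel A n v × x ≡ ⟪ n , ⌜ toList v ⌝ ⟫)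
    × EnumeratedBy ∅ q (λ x → ∃[ n ] Σ[ v ∈ Vec ℕ (arity n) ]
        n ∈ RelSym × Allᵛ (dom A) v × ¬ rel A n v × x ≡ ⟪ n , ⌜ toList v ⌝ ⟫)
    × EnumeratedBy ∅ g (λ x → ∃[ m ] Σ[ v ∈ Vec ℕ (arity m) ]
        m ∈ FunSym × Allᵛ (dom A) v × x ≡ ⟪ m , ⟪ ⌜ toList v ⌝ , fun A m v ⟫ ⟫)

  ComputableStructure : Structure L → Set
  ComputableStructure A = ∃[ e ] IsIndex e A

  record Age : Set₁ where
    field
      members    : Pred (Structure L) 0ℓ
      fg         : ∀ {A} → A ∈ members → FinitelyGenerated A
      iso-closed : ∀ {A B} → A ∈ members → A ≅ B → B ∈ members

  open Age public using (members)

  ≅-trans : ∀ {A B C : Structure L} → A ≅ B → B ≅ C → A ≅ C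
  ≅-trans {A} {B} {C} (f , f-onto) (g , g-onto) = gf , onto
    where
    into-all : ∀ {l} {v : Vec ℕ l} → Allᵛ (dom A) v → Allᵛ (dom B) (Vec.map (map-of f) v)
    into-all p = Allᵛ-map⁺ (VecAll.map (into f) p)

    gf : A ↪ C
    map-of gf = map-of g ∘ map-of f
    into gf = into g ∘ into f
    injective gf x∈ y∈ eq = injective f x∈ y∈ (injective g (into f x∈) (into f y∈) eq)
    rel-⇔ gf {n} s {v} p = mk⇔
      (subst (rel C n) (sym (VecProp.map-∘ (map-of g) (map-of f) v))
        ∘ Equivalence.to (rel-⇔ g s (into-all p)) ∘ Equivalence.to (rel-⇔ f s p))
      (Equivalence.from (rel-⇔ f s p) ∘ Equivalence.from (rel-⇔ g s (into-all p))
        ∘ subst (rel C n) (VecProp.map-∘ (map-of g) (map-of f) v))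
    fun-≡ gf {m} s {v} p = trans (cong (map-of g) (fun-≡ f s p))
      (trans (fun-≡ g s (into-all p))
             (cong (fun C m) (sym (VecProp.map-∘ (map-of g) (map-of f) v))))

    onto : Onto gf
    onto z∈ with g-onto z∈
    ... | y , y∈ , refl with f-onto y∈
    ...   | x , x∈ , refl = x , x∈ , refl

  module _ {M B : Structure L} {a : List ℕ} (f : cl M a ↪ B) where
    mutual
      Gen-image : ∀ {x} → Gen M a x → Gen B (map (map-of f) a) (map-of f x)
      Gen-image (gen x∈a) = gen (∈-map⁺ (map-of f) x∈a)
      Gen-image (app s p) =
        subst (Gen B _) (sym (fun-≡ f s p)) (app s (Gen-images p))

      Gen-images : ∀ {l} {v : Vec ℕ l} → Allᵛ (Gen M a) v →
                   Allᵛ (Gen B (map (map-of f) a)) (Vec.map (map-of f) v)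
      Gen-images []       = []
      Gen-images (p ∷ ps) = Gen-image p ∷ Gen-images ps

  ageOf : Structure L → Age
  ageOf M = record
    { members    = λ B → ∃[ a ] All (dom M) a × cl M a ≅ B
    ; fg         = λ { {B} (a , _ , f , onto) →
        map (map-of f) a ,
        All-map⁺ (ListAll.tabulate (into f ∘ gen)) ,
        λ y∈ → let (x , x∈ , eq) = onto y∈ in subst (Gen B _) eq (Gen-image f x∈) }
    ; iso-closed = λ { {A} {B} (a , a⊆M , i) j → a , a⊆M , ≅-trans i j }
    }

  -- A computable representation of the age 𝒦, with 𝕀(i) = (tuple i , struct i , i).
  record ComputableAge (𝒦 : Age) : Set₁ where
    field
      tuple     : ℕ → List ℕ
      struct    : ℕ → Structure L
      index     : ℕ → ℕ
      indexes   : ∀ i → IsIndex (index i) (struct i)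
      member    : ∀ i → struct i ∈ members 𝒦
      tuple⊆    : ∀ i → All (dom (struct i)) (tuple i)
      generates : ∀ i {x} → x ∈ dom (struct i) → x ∈ Gen (struct i) (tuple i)
      complete  : ∀ {B} → B ∈ members 𝒦 → ∃[ i ] struct i ≅ B

    ⌜𝕀⌝ : ℕ → ℕ
    ⌜𝕀⌝ i = ⟪ ⌜ tuple i ⌝ , ⟪ index i , i ⟫ ⟫

    field
      triples-ce : CE (λ x → ∃[ i ] x ≡ ⌜𝕀⌝ i)

  record Canonical (M : Structure L) (𝕂 : ComputableAge (ageOf M)) : Set where
    open ComputableAge 𝕂
    field
      tuple⊆M         : ∀ i → All (dom M) (tuple i)
      infinitelyOften : ∀ {a} → All (dom M) a → ∀ n → ∃[ i ] n ≤ i × tuple i ≡ a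
      tuple-comp      : ComputableFun (λ i → ⌜ tuple i ⌝)
      struct-cl       : ∀ i → struct i ≐ cl M (tuple i)

  AmalgamationBase : Age → Structure L → Set₁
  AmalgamationBase 𝒦 A =
    A ∈ members 𝒦 ×
    (∀ {B C} → B ∈ members 𝒦 → C ∈ members 𝒦 → (f : A ↪ B) (g : A ↪ C) →
      ∃[ D ] D ∈ members 𝒦 × Σ[ α ∈ B ↪ D ] Σ[ β ∈ C ↪ D ]
        (∀ {x} → x ∈ dom A → map-of α (map-of f x) ≡ map-of β (map-of g x)))

  CAP : Age → Set₁
  CAP 𝒦 = ∀ {A} → A ∈ members 𝒦 → ∃[ A′ ] AmalgamationBase 𝒦 A′ × A ↪ A′

  -- Since 𝕀(i) is determined by i, the triple (𝕀(i) , 𝕀(j) , c) is given by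
  -- i, j and c.
  record Arrow : Set where
    constructor arrow
    field
      source target : ℕ
      image         : List ℕ

  open Arrow public

  module _ {𝒦 : Age} (𝕂 : ComputableAge 𝒦) where
    open ComputableAge 𝕂

    ⌜_⌝ᵃ : Arrow → ℕ
    ⌜ arrow i j c ⌝ᵃ = ⟪ ⌜𝕀⌝ i , ⟪ ⌜𝕀⌝ j , ⌜ c ⌝ ⟫ ⟫

    PotentialEmbedding : Pred Arrow 0ℓ
    PotentialEmbedding (arrow i j c) = All (dom (struct j)) c

    IsEmbedding : Pred Arrow 0ℓ
    IsEmbedding F@(arrow i j c) = PotentialEmbedding F × (struct i , tuple i ≃ struct j , c)

    Encodes : (F : Arrow) → struct (source F) ↪ struct (target F) → Set
    Encodes F f = map (map-of f) (tuple (source F)) ≡ image F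

    IsIsomorphism : Pred Arrow 0ℓ
    IsIsomorphism F = IsEmbedding F × ∃[ f ] Encodes F f × Onto f

    -- E = G ∘ F.
    record IsComposite (G F E : Arrow) : Set where
      field
        middle      : target F ≡ source G
        source-≡    : source E ≡ source F
        target-≡    : target E ≡ target G
        F̂           : struct (source F) ↪ struct (target F)
        Ĝ           : struct (source G) ↪ struct (target G)
        Ê           : struct (source E) ↪ struct (target E)
        F-encodes   : Encodes F F̂
        G-encodes   : Encodes G Ĝ
        E-encodes   : Encodes E Ê
        composition : ∀ {x} → x ∈ dom (struct (source F)) →
                      map-of Ê x ≡ map-of Ĝ (map-of F̂ x)

    PotentialSpan : Arrow → Arrow → Set
    PotentialSpan F₀ F₁ =
      PotentialEmbedding F₀ × PotentialEmbedding F₁ × source F₀ ≡ source F₁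

    Span : Arrow → Arrow → Set
    Span F₀ F₁ = PotentialSpan F₀ F₁ × IsEmbedding F₀ × IsEmbedding F₁

    record AmalgamationDiagram (F₀ F₁ G₀ G₁ : Arrow) : Set where
      field
        embedding₀ : IsEmbedding G₀
        potential₁ : PotentialEmbedding G₁
        source₀    : source G₀ ≡ target F₀
        source₁    : source G₁ ≡ target F₁
        target-≡   : target G₀ ≡ target G₁
        if-span    : Span F₀ F₁ →
                     IsEmbedding G₁ × ∃[ E ] IsComposite G₀ F₀ E × IsComposite G₁ F₁ E

    record DistinguishedExtensions (AB : Pred Arrow 0ℓ) : Set where
      field
        embeddings  : ∀ {F} → F ∈ AB → IsEmbedding F
        precompose  : ∀ {F H E} → F ∈ AB → IsIsomorphism H → IsComposite F H E → E ∈ AB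
        postcompose : ∀ {F H E} → F ∈ AB → IsIsomorphism H → IsComposite H F E → E ∈ AB
        cofinal     : ∀ i → ∃[ F ] F ∈ AB × source F ≡ i

    -- The arguments at which the partial function of a witness must be defined.
    Admissible : Pred Arrow 0ℓ → Arrow → Arrow → Arrow → Set
    Admissible AB F G₀ G₁ = F ∈ AB × PotentialSpan G₀ G₁ × source G₀ ≡ target F

    -- The values of amalgam at arguments that are not Admissible are irrelevant.
    record CAPWitness : Set₁ where
      field
        AB            : Pred Arrow 0ℓ
        amalgam       : Arrow → Arrow → Arrow → Arrow × Arrow
        distinguished : DistinguishedExtensions AB
        bases         : ∀ {F} → F ∈ AB → AmalgamationBase 𝒦 (struct (target F))
        amalgamates   : ∀ {F G₀ G₁} → Admissible AB F G₀ G₁ →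
                        let (H₀ , H₁) = amalgam F G₀ G₁ in AmalgamationDiagram G₀ G₁ H₀ H₁

    ComputableWitness : Pred ℕ 0ℓ → CAPWitness → Set
    ComputableWitness S w =
      CE-in S (λ x → ∃[ F ] F ∈ AB × x ≡ ⌜ F ⌝ᵃ) ×
      (∃[ e ] ∀ {F G₀ G₁} → Admissible AB F G₀ G₁ →
        let (H₀ , H₁) = amalgam F G₀ G₁ in
        φ S e ⟪ ⌜ F ⌝ᵃ , ⟪ ⌜ G₀ ⌝ᵃ , ⌜ G₁ ⌝ᵃ ⟫ ⟫ ⟪ ⌜ H₀ ⌝ᵃ , ⌜ H₁ ⌝ᵃ ⟫)
      where open CAPWitness w

    cCAP : Pred ℕ 0ℓ → Set₁
    cCAP S = ∃[ w ] ComputableWitness S w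

{-# OPTIONS --safe #-}

module Submission where

-- M is a digraph on ω.  It consists of a rigid spine 0, 1, 2, … and of points,
-- each attached to at most two places of the spine.  Point ⟪ e , 0 ⟫ is attached to
-- one place; if the program e halts on e after exactly t steps, then point ⟪ e , t ⟫
-- is attached to the same place and to a second one, further out than t.
--
-- A finite set of points together with a long enough piece of the spine has only
-- one embedding into M, so unions in M amalgamate over it, whence (CAP).  On the
-- other hand, if e halts at time t, then a finite part of M that contains
-- point ⟪ e , 0 ⟫ but nothing numbered t or more is not an amalgamation base: it can
-- be moved to point ⟪ e , t ⟫, and the two positions are told apart by a longer
-- piece of the spine.  Hence every amalgamation base above the piece of M that
-- surrounds point ⟪ e , 0 ⟫ bounds the halting time of e, and an enumeration of the
-- distinguished extensions, relative to 𝔰, decides the halting problem.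

open import Defs
open import Axiom.ExcludedMiddle using (ExcludedMiddle)
open import Data.Empty using (⊥-elim)
open import Data.Fin as Fin using (Fin; cast)
open import Data.List using (List; []; _∷_; map; _++_; length; lookup; applyDownFrom)
open import Data.List.Membership.Propositional using () renaming (_∈_ to _∈ˡ_; _∉_ to _∉ˡ_)
open import Data.List.Membership.Propositional.Properties
  using (∈-map⁺; ∈-++⁺ˡ; ∈-++⁺ʳ; ∈-++⁻; ∈-lookup; ∈-applyDownFrom⁺; ∈-applyDownFrom⁻)
open import Data.List.Relation.Unary.All using (All)
import Data.List.Relation.Unary.All as ListAll
open import Data.List.Relation.Unary.Any using (here; there) renaming (index to position-of)
open import Data.List.Relation.Unary.Any.Properties using (lookup-index)
open import Data.Nat
open import Data.Nat.Induction using (<-wellFounded; Acc; acc)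
open import Data.Nat.Properties
open import Data.Product using (∃; ∃-syntax; Σ-syntax; _×_; _,_; proj₁; proj₂)
open import Data.Sum using (_⊎_; inj₁; inj₂)
import Data.Sum as Sum
open import Data.Unit using (⊤; tt)
open import Data.Vec using (Vec; []; _∷_; toList)
import Data.Vec as Vec
import Data.Vec.Properties as VecProp
open import Data.Vec.Relation.Unary.All using ([]; _∷_) renaming (All to Allᵛ)
import Data.Vec.Relation.Unary.All as VecAll
open import Data.Vec.Relation.Unary.All.Properties using () renaming (map⁺ to Allᵛ-map⁺)
open import Function using (_∘_; id; _⇔_; mk⇔; Equivalence)
open import Level using (0ℓ; Lift; lift; lower) renaming (suc to lsuc)
open import Relation.Binary.Definitions using (tri<; tri≈; tri>)
open import Relation.Binary.PropositionalEquality
  using (_≡_; _≢_; refl; sym; trans; cong; cong₂; subst; subst₂; module ≡-Reasoning)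
open import Relation.Nullary using (¬_; yes; no; Dec)
open import Relation.Nullary.Decidable using () renaming (map′ to map-dec)
open import Relation.Unary using (Pred; _∈_; ∅)

open Equivalence using (to; from)

-- Pairing

-- The second place belongs to point `⟪ e , t ⟫` and not to point `⟪ e , 0 ⟫` because halting after
-- exactly t steps is decidable, while halting is not: this keeps M computable. It also requires a
-- clock. `Eval` is a big-step relation without one, so a universal stack machine is built first,
-- whose steps can be counted. Times become numbers of points because both the pairing and the
-- coding of lists are monotone: a member of a list is smaller than the code of the list, so a list
-- with code below t contains neither point `⟪ e , t ⟫` nor the second place of that point. Hence
-- the code of the tuple of an amalgamation base is itself the bound for the halting time. (CAP)
-- fails to be effective in the choice of a long enough spine, which has to reach past the second
-- points of all halting programs whose first points are in the given set. The existence of such a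
-- bound is taken from excluded middle, which also inverts isomorphisms with undecidable domains and
-- turns 𝔰 into a characteristic function for the machine.

next : ℕ × ℕ → ℕ × ℕ
next (zero  , n) = suc n , zero
next (suc m , n) = m , suc n

⟪⟫-suc : ∀ m n → ⟪ m , suc n ⟫ ≡ suc ⟪ suc m , n ⟫
⟪⟫-suc m n = trans (cong (λ k → triangle k + suc n) (+-suc m n)) (+-suc _ n)

⟪suc,0⟫ : ∀ n → ⟪ suc n , 0 ⟫ ≡ suc ⟪ 0 , n ⟫
⟪suc,0⟫ n = cong suc (begin
  n + 0 + triangle (n + 0) + 0  ≡⟨ +-identityʳ _ ⟩
  n + 0 + triangle (n + 0)      ≡⟨ cong (λ k → k + triangle k) (+-identityʳ n) ⟩
  n + triangle n                ≡⟨ +-comm n _ ⟩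
  triangle n + n                ∎)
  where open ≡-Reasoning

-- `next` moves along the antidiagonals of Cantor's enumeration, so that plain iteration of it
-- inverts the pairing.
⟪⟫-next : ∀ p → ⟪ proj₁ (next p) , proj₂ (next p) ⟫ ≡ suc ⟪ proj₁ p , proj₂ p ⟫
⟪⟫-next (zero  , n) = ⟪suc,0⟫ n
⟪⟫-next (suc m , n) = ⟪⟫-suc m n

abstract
  unpair : ℕ → ℕ × ℕ
  unpair zero    = 0 , 0
  unpair (suc k) = next (unpair k)

  ⟪⟫-unpair : ∀ k → ⟪ proj₁ (unpair k) , proj₂ (unpair k) ⟫ ≡ k
  ⟪⟫-unpair zero    = refl
  ⟪⟫-unpair (suc k) = trans (⟪⟫-next (unpair k)) (cong suc (⟪⟫-unpair k))

  unpair-unique : ∀ k m n → ⟪ m , n ⟫ ≡ k → unpair k ≡ (m , n)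
  unpair-unique zero    zero    zero    _  = refl
  unpair-unique (suc k) (suc m) zero    eq
    rewrite unpair-unique k 0 m (suc-injective (trans (sym (⟪suc,0⟫ m)) eq)) = refl
  unpair-unique zero    m       (suc n) eq with () ← trans (sym (⟪⟫-suc m n)) eq
  unpair-unique (suc k) m       (suc n) eq
    rewrite unpair-unique k (suc m) n (suc-injective (trans (sym (⟪⟫-suc m n)) eq)) = refl

  left right : ℕ → ℕ
  left  = proj₁ ∘ unpair
  right = proj₂ ∘ unpair

  left-⟪⟫ : ∀ m n → left ⟪ m , n ⟫ ≡ m
  left-⟪⟫ m n = cong proj₁ (unpair-unique _ m n refl)

  right-⟪⟫ : ∀ m n → right ⟪ m , n ⟫ ≡ n
  right-⟪⟫ m n = cong proj₂ (unpair-unique _ m n refl)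

  ⟪left,right⟫ : ∀ k → ⟪ left k , right k ⟫ ≡ k
  ⟪left,right⟫ = ⟪⟫-unpair

⟪⟫-injective : ∀ m n m′ n′ → ⟪ m , n ⟫ ≡ ⟪ m′ , n′ ⟫ → m ≡ m′ × n ≡ n′
⟪⟫-injective m n m′ n′ eq =
  trans (sym (left-⟪⟫ m n)) (trans (cong left eq) (left-⟪⟫ m′ n′)) ,
  trans (sym (right-⟪⟫ m n)) (trans (cong right eq) (right-⟪⟫ m′ n′))

triangle-mono : ∀ {m n} → m ≤ n → triangle m ≤ triangle n
triangle-mono z≤n       = z≤n
triangle-mono (s≤s m≤n) = +-mono-≤ (s≤s m≤n) (triangle-mono m≤n)

⟪⟫-mono : ∀ {m n m′ n′} → m ≤ m′ → n ≤ n′ → ⟪ m , n ⟫ ≤ ⟪ m′ , n′ ⟫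
⟪⟫-mono p q = +-mono-≤ (triangle-mono (+-mono-≤ p q)) q

n≤triangle : ∀ n → n ≤ triangle n
n≤triangle zero    = z≤n
n≤triangle (suc n) = m≤m+n (suc n) (triangle n)

m≤⟪m,n⟫ : ∀ m n → m ≤ ⟪ m , n ⟫
m≤⟪m,n⟫ m n = ≤-trans (m≤m+n m n) (≤-trans (n≤triangle (m + n)) (m≤m+n _ n))

n≤⟪m,n⟫ : ∀ m n → n ≤ ⟪ m , n ⟫
n≤⟪m,n⟫ m n = m≤n+m n (triangle (m + n))

-- Determinism of evaluation

abstract
  eval-deterministic : ∀ {S c n x y} → Eval S c n x → Eval S c n y → x ≡ y
  eval-deterministic e e′ = det e e′ refl
    where
    -- The two inputs are linked by an equation only, since pairs `⟪ m , n ⟫` in the indices of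
    -- `Eval` do not unify.
    det : ∀ {S c n n′ x y} → Eval S c n x → Eval S c n′ y → n ≡ n′ → x ≡ y
    det e-zero       e-zero         _  = refl
    det e-succ       e-succ         eq = cong suc eq
    det (e-left {m} {n}) (e-left {m′} {n′}) eq = proj₁ (⟪⟫-injective m n m′ n′ eq)
    det (e-right {m} {n}) (e-right {m′} {n′}) eq = proj₂ (⟪⟫-injective m n m′ n′ eq)
    det (e-yes _)    (e-yes _)      _  = refl
    det (e-yes p)    (e-no ¬p)      refl = ⊥-elim (¬p p)
    det (e-no ¬p)    (e-yes p)      refl = ⊥-elim (¬p p)
    det (e-no _)     (e-no _)       _  = refl
    det (e-pair a b) (e-pair a′ b′) eq = cong₂ ⟪_,_⟫ (det a a′ eq) (det b b′ eq)
    det (e-comp a b) (e-comp a′ b′) eq = det b b′ (det a a′ eq)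
    det (e-prec₀ {n = n} a) (e-prec₀ {n = n′} a′) eq =
      det a a′ (proj₁ (⟪⟫-injective n 0 n′ 0 eq))
    det (e-prec₀ {n = n} a) (e-precₛ {n = n′} {k = k′} _ _) eq
      with () ← proj₂ (⟪⟫-injective n 0 n′ (suc k′) eq)
    det (e-precₛ {n = n} {k = k} _ _) (e-prec₀ {n = n′} _) eq
      with () ← proj₂ (⟪⟫-injective n (suc k) n′ 0 eq)
    det (e-precₛ {n = n} {k = k} a b) (e-precₛ {n = n′} {k = k′} a′ b′) eq
      with ⟪⟫-injective n (suc k) n′ (suc k′) eq
    ... | refl , refl = det b b′ (cong (λ x → ⟪ n , ⟪ k , x ⟫ ⟫) (det a a′ refl))
    det (e-mu {k = k} a f) (e-mu {k = k′} a′ f′) refl with <-cmp k k′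
    ... | tri≈ _ k≡k′ _ = k≡k′
    ... | tri< k<k′ _ _ with () ← det a (proj₂ (f′ k k<k′)) refl
    ... | tri> _ _ k′<k with () ← det (proj₂ (f k′ k′<k)) a′ refl

-- Total computable functions

record Comp (S : Pred ℕ 0ℓ) (f : ℕ → ℕ) : Set where
  constructor comp
  field
    code    : Code
    correct : ∀ n → Eval S code n (f n)

open Comp public

primrec : (ℕ → ℕ) → (ℕ → ℕ) → ℕ → ℕ → ℕ
primrec f g n zero    = f n
primrec f g n (suc k) = g ⟪ n , ⟪ k , primrec f g n k ⟫ ⟫

iter : (ℕ → ℕ) → ℕ → ℕ → ℕ
iter g zero    n = n
iter g (suc k) n = g (iter g k n)

iter-comm : ∀ g k n → iter g k (g n) ≡ g (iter g k n)
iter-comm g zero    n = refl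
iter-comm g (suc k) n = cong g (iter-comm g k n)

-- In tests, 0 stands for truth.
ifz : ℕ → ℕ → ℕ → ℕ
ifz zero    a b = a
ifz (suc _) a b = b

ifz-zero : ∀ {z a b} → z ≡ 0 → ifz z a b ≡ a
ifz-zero refl = refl

ifz-nonzero : ∀ {z a b} → z ≢ 0 → ifz z a b ≡ b
ifz-nonzero {zero}  z≢0 = ⊥-elim (z≢0 refl)
ifz-nonzero {suc _} _   = refl

not : ℕ → ℕ
not n = ifz n 1 0

not≡0 : ∀ {n} → not n ≡ 0 ⇔ (n ≢ 0)
not≡0 {zero}  = mk⇔ (λ ()) (λ 0≢0 → ⊥-elim (0≢0 refl))
not≡0 {suc n} = mk⇔ (λ _ ()) (λ _ → refl)

pick : ℕ → List ℕ → ℕ → ℕ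
pick _       []       d = d
pick zero    (b ∷ _)  d = b
pick (suc k) (_ ∷ bs) d = pick k bs d

opaque
  dist : ℕ → ℕ → ℕ
  dist m n = (m ∸ n) + (n ∸ m)

  dist-refl : ∀ n → dist n n ≡ 0
  dist-refl n = cong₂ _+_ (n∸n≡0 n) (n∸n≡0 n)

  dist≡0 : ∀ {m n} → dist m n ≡ 0 → m ≡ n
  dist≡0 {m} {n} eq = ≤-antisym
    (m∸n≡0⇒m≤n (m+n≡0⇒m≡0 (m ∸ n) eq))
    (m∸n≡0⇒m≤n (m+n≡0⇒n≡0 (m ∸ n) eq))

-- `e-mu` demands positive values at all smaller arguments, so a known zero has to be replaced by
-- the first one.
least-zero : ∀ (g : ℕ → ℕ) k → g k ≡ 0 →
             ∃[ l ] g l ≡ 0 × (∀ j → j < l → ∃ λ v → g j ≡ suc v)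
least-zero g zero    eq = 0 , eq , λ _ ()
least-zero g (suc k) eq with least-zero (g ∘ suc) k eq | g 0 in eq₀
... | _             | zero  = 0 , eq₀ , λ _ ()
... | l , eqₗ , pos | suc v = suc l , eqₗ , λ where
  zero    _       → v , eq₀
  (suc j) (s≤s p) → pos j p

module _ {S : Pred ℕ 0ℓ} where

  infixr 9 _∘ᶜ_

  private
    Fn = ℕ → ℕ

  ext : ∀ {f g : Fn} → (∀ n → f n ≡ g n) → Comp S f → Comp S g
  ext eq (comp c p) = comp c λ n → subst (Eval S c n) (eq n) (p n)

  abstract
    _∘ᶜ_ : ∀ {f g : Fn} → Comp S f → Comp S g → Comp S (f ∘ g)
    comp c p ∘ᶜ comp d q = comp (compᶜ c d) λ n → e-comp (q n) (p _)

    ⟪_,_⟫ᶜ : ∀ {f g : Fn} → Comp S f → Comp S g → Comp S (λ n → ⟪ f n , g n ⟫)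
    ⟪ comp c p , comp d q ⟫ᶜ = comp (pairᶜ c d) λ n → e-pair (p n) (q n)

    suc′ : Comp S suc
    suc′ = comp succᶜ λ _ → e-succ

    left′ : Comp S left
    left′ = comp leftᶜ λ n → subst (λ k → Eval S leftᶜ k (left n)) (⟪left,right⟫ n) (e-left {m = left n} {right n})

    right′ : Comp S right
    right′ = comp rightᶜ λ n → subst (λ k → Eval S rightᶜ k (right n)) (⟪left,right⟫ n) (e-right {m = left n} {right n})

    id′ : Comp S id
    id′ = ext ⟪left,right⟫ ⟪ left′ , right′ ⟫ᶜ

    const′ : ∀ k → Comp S (λ _ → k)
    const′ zero    = comp zeroᶜ λ _ → e-zero
    const′ (suc k) = suc′ ∘ᶜ const′ k

    primrec′ : ∀ {f g : Fn} → Comp S f → Comp S g →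
               Comp S (λ n → primrec f g (left n) (right n))
    primrec′ {f} {g} (comp c p) (comp d q) = comp (precᶜ c d) λ n →
      subst (λ k → Eval S (precᶜ c d) k (primrec f g (left n) (right n)))
        (⟪left,right⟫ n) (go (left n) (right n))
      where
      go : ∀ n k → Eval S (precᶜ c d) ⟪ n , k ⟫ (primrec f g n k)
      go n zero    = e-prec₀ {n = n} (p n)
      go n (suc k) = e-precₛ {n = n} {k = k} (go n k) (q ⟪ n , ⟪ k , primrec f g n k ⟫ ⟫)

  primrecᶜ : ∀ {f g h k : Fn} → Comp S f → Comp S g → Comp S h → Comp S k →
             Comp S (λ n → primrec f g (h n) (k n))
  primrecᶜ {f} {g} {h} {k} F G H K =
    ext (λ n → cong₂ (primrec f g) (left-⟪⟫ (h n) (k n)) (right-⟪⟫ (h n) (k n)))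
      (primrec′ F G ∘ᶜ ⟪ H , K ⟫ᶜ)

  sucᶜ : ∀ {f : Fn} → Comp S f → Comp S (λ n → suc (f n))
  sucᶜ F = suc′ ∘ᶜ F

  lᶜ : ∀ {f : Fn} → Comp S f → Comp S (λ n → left (f n))
  lᶜ F = left′ ∘ᶜ F

  rᶜ : ∀ {f : Fn} → Comp S f → Comp S (λ n → right (f n))
  rᶜ F = right′ ∘ᶜ F

  abstract
    iterᶜ : ∀ {g h k : Fn} → Comp S g → Comp S k → Comp S h →
            Comp S (λ n → iter g (k n) (h n))
    iterᶜ {g} {h} {k} G K H = ext (λ n → lemma (h n) (k n))
      (primrecᶜ id′ (G ∘ᶜ rᶜ right′) H K)
      where
      lemma : ∀ n k → primrec id (λ x → g (right (right x))) n k ≡ iter g k n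
      lemma n zero    = refl
      lemma n (suc k) = let r = primrec id (λ x → g (right (right x))) n k in
        cong g (trans (cong right (right-⟪⟫ n ⟪ k , r ⟫)) (trans (right-⟪⟫ k r) (lemma n k)))

    predᶜ : ∀ {f : Fn} → Comp S f → Comp S (λ n → pred (f n))
    predᶜ {f} F = ext (λ n → lemma (f n)) (primrecᶜ (const′ 0) (lᶜ right′) (const′ 0) F)
      where
      lemma : ∀ k → primrec (λ _ → 0) (λ x → left (right x)) 0 k ≡ pred k
      lemma zero    = refl
      lemma (suc k) = let r = primrec (λ _ → 0) (λ x → left (right x)) 0 k in
        trans (cong left (right-⟪⟫ 0 ⟪ k , r ⟫)) (left-⟪⟫ k r)

    ifzᶜ : ∀ {f g h : Fn} → Comp S f → Comp S g → Comp S h →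
           Comp S (λ n → ifz (f n) (g n) (h n))
    ifzᶜ {f} {g} {h} F G H = ext (λ n → lemma (f n) (g n) (h n))
      (primrecᶜ left′ (rᶜ left′) ⟪ G , H ⟫ᶜ F)
      where
      lemma : ∀ k a b → primrec left (λ x → right (left x)) ⟪ a , b ⟫ k ≡ ifz k a b
      lemma zero    a b = left-⟪⟫ a b
      lemma (suc k) a b = let r = primrec left (λ x → right (left x)) ⟪ a , b ⟫ k in
        trans (cong right (left-⟪⟫ ⟪ a , b ⟫ ⟪ k , r ⟫)) (right-⟪⟫ a b)

    pick-[] : ∀ k d → d ≡ pick k [] d
    pick-[] zero    d = refl
    pick-[] (suc k) d = refl

    _+ᶜ_ : ∀ {f g : Fn} → Comp S f → Comp S g → Comp S (λ n → f n + g n)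
    _+ᶜ_ {f} {g} F G = ext (λ n → lemma (f n) (g n)) (iterᶜ suc′ F G)
      where
      lemma : ∀ k n → iter suc k n ≡ k + n
      lemma zero    n = refl
      lemma (suc k) n = cong suc (lemma k n)

    _∸ᶜ_ : ∀ {f g : Fn} → Comp S f → Comp S g → Comp S (λ n → f n ∸ g n)
    _∸ᶜ_ {f} {g} F G = ext (λ n → lemma (g n) (f n)) (iterᶜ (predᶜ id′) G F)
      where
      lemma : ∀ k n → iter pred k n ≡ n ∸ k
      lemma zero    n = refl
      lemma (suc k) n = trans (cong pred (lemma k n)) (pred[m∸n]≡m∸[1+n] n k)

  opaque
    unfolding dist

    distᶜ : ∀ {f g : Fn} → Comp S f → Comp S g → Comp S (λ n → dist (f n) (g n))
    distᶜ F G = (F ∸ᶜ G) +ᶜ (G ∸ᶜ F)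

  data Branches : (ℕ → List ℕ) → Set where
    []  : Branches (λ _ → [])
    _∷_ : ∀ {f fs} → Comp S f → Branches fs → Branches (λ n → f n ∷ fs n)

  pickᶜ : ∀ {f d : Fn} {fs} → Comp S f → Branches fs → Comp S d →
          Comp S (λ n → pick (f n) (fs n) (d n))
  pickᶜ {f} {d} F [] D = ext (λ n → pick-[] (f n) (d n)) D
  pickᶜ {f} {d} F (_∷_ {b} {bs} B Bs) D =
    ext (λ n → lemma (f n) (b n) (bs n) (d n))
      (ifzᶜ F B (pickᶜ (predᶜ F) Bs D))
    where
    lemma : ∀ k b bs d → ifz k b (pick (pred k) bs d) ≡ pick k (b ∷ bs) d
    lemma zero    b bs d = refl
    lemma (suc k) b bs d = refl

  abstract
    -- The variable of the minimisation is ignored: the search stops at once if f n is 0 and runs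
    -- forever otherwise.
    semidecide : ∀ {f : Fn} → Comp S f → Code
    semidecide F = muᶜ (code (F ∘ᶜ left′))

    semidecide-complete : ∀ {f : Fn} (F : Comp S f) {n} → f n ≡ 0 → Eval S (semidecide F) n 0
    semidecide-complete {f} F {n} eq = e-mu
      (subst (Eval S _ _) (trans (cong f (left-⟪⟫ n 0)) eq) (correct (F ∘ᶜ left′) _))
      (λ _ ())

    semidecide-sound : ∀ {f : Fn} (F : Comp S f) {n m} → Eval S (semidecide F) n m → f n ≡ 0
    semidecide-sound {f} F {n} {m} (e-mu e _) = trans (cong f (sym (left-⟪⟫ n m)))
      (eval-deterministic (correct (F ∘ᶜ left′) _) e)

  abstract
    search : ∀ {f : Fn} → Comp S f → Code
    search F = muᶜ (code F)

    search-correct : ∀ {f : Fn} (F : Comp S f) n k → f ⟪ n , k ⟫ ≡ 0 →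
                     ∃[ l ] Eval S (search F) n l × f ⟪ n , l ⟫ ≡ 0
    search-correct {f} F n k eq with least-zero (λ l → f ⟪ n , l ⟫) k eq
    ... | l , eqₗ , pos =
      l ,
      e-mu (subst (Eval S _ _) eqₗ (correct F _))
           (λ j j<l → let (v , eqⱼ) = pos j j<l in v , subst (Eval S _ _) eqⱼ (correct F _)) ,
      eqₗ

-- A universal stack machine: run evaluates the program number c at n, ret hands
-- the value v to the topmost frame, and chk checks that c is the number of a
-- program at all, which run alone would not notice for a subprogram that is
-- never executed.
opaque
  run : ℕ → ℕ → ℕ → ℕ
  run c n K = ⟪ 0 , ⟪ ⟪ c , n ⟫ , K ⟫ ⟫

  ret chk : ℕ → ℕ → ℕ
  ret v K = ⟪ 1 , ⟪ v , K ⟫ ⟫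
  chk c K = ⟪ 2 , ⟪ c , K ⟫ ⟫

  stuck done : ℕ
  stuck = ⟪ 3 , 0 ⟫
  done  = ⟪ 4 , 0 ⟫

  push : ℕ → ℕ → ℕ → ℕ
  push f p K = ⟪ ⟪ f , p ⟫ , K ⟫

-- In `gödel`, operations 0 to 4 carry the argument 0; any other argument shows that the number
-- belongs to no program. The value 0 returned by a successful check is a dummy.
chkOp : ℕ → ℕ → ℕ → ℕ
chkOp op arg K = pick op (leaf ∷ leaf ∷ leaf ∷ leaf ∷ leaf ∷ node ∷ node ∷ node ∷ chk arg K ∷ []) stuck
  where
  leaf = ifz arg (ret 0 K) stuck
  node = chk (left arg) (push 5 (right arg) K)

-- Frames 0 and 1 belong to pairᶜ, 2 to compᶜ, 3 to precᶜ and 4 to muᶜ; 5 waits for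
-- the first half of a check, 6 starts a program after its check, 7 is the bottom.
retFrame : ℕ → ℕ → ℕ → ℕ → ℕ
retFrame f p v K = pick f
  ( run (left p) (right p) (push 1 v K)
  ∷ ret ⟪ p , v ⟫ K
  ∷ run p v K
  ∷ run (left p) ⟪ left (right p) , ⟪ right (right p) , v ⟫ ⟫ K
  ∷ ifz v (ret (right (right p)) K)
      (run (left p) ⟪ left (right p) , suc (right (right p)) ⟫
        (push 4 ⟪ left p , ⟪ left (right p) , suc (right (right p)) ⟫ ⟫ K))
  ∷ chk p K
  ∷ run (left p) (right p) K
  ∷ done
  ∷ []) stuck

module _ (χ : ℕ → ℕ) where

  runOp : ℕ → ℕ → ℕ → ℕ → ℕ
  runOp op arg n K = pick op
    ( ret 0 K
    ∷ ret (suc n) K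
    ∷ ret (left n) K
    ∷ ret (right n) K
    ∷ ret (χ n) K
    ∷ run (left arg) n (push 0 ⟪ right arg , n ⟫ K)
    ∷ run (right arg) n (push 2 (left arg) K)
    ∷ ifz (right n) (run (left arg) (left n) K)
        (run ⟪ op , arg ⟫ ⟪ left n , pred (right n) ⟫
          (push 3 ⟪ right arg , ⟪ left n , pred (right n) ⟫ ⟫ K))
    ∷ run arg ⟪ n , 0 ⟫ (push 4 ⟪ arg , ⟪ n , 0 ⟫ ⟫ K)
    ∷ []) stuck

  modes : ℕ → List ℕ
  modes s =
      runOp (left (left (left (right s)))) (right (left (left (right s))))
            (right (left (right s))) (right (right s))
    ∷ retFrame (left (left (right (right s)))) (right (left (right (right s))))
               (left (right s)) (right (right (right s)))
    ∷ chkOp (left (left (right s))) (right (left (right s))) (right (right s))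
    ∷ []

  -- The default `s` makes states of modes 3 and 4 fixed: a stuck machine runs forever, which is
  -- divergence, and a halted one stays halted.
  step : ℕ → ℕ
  step s = pick (left s) (modes s) s

module _ {S : Pred ℕ 0ℓ} where

  private
    Fn = ℕ → ℕ

  opaque
    unfolding run

    runᶜ : ∀ {c n K : Fn} → Comp S c → Comp S n → Comp S K → Comp S (λ s → run (c s) (n s) (K s))
    runᶜ C N K = ⟪ const′ 0 , ⟪ ⟪ C , N ⟫ᶜ , K ⟫ᶜ ⟫ᶜ

    retᶜ : ∀ {v K : Fn} → Comp S v → Comp S K → Comp S (λ s → ret (v s) (K s))
    retᶜ V K = ⟪ const′ 1 , ⟪ V , K ⟫ᶜ ⟫ᶜ

    chkᶜ : ∀ {c K : Fn} → Comp S c → Comp S K → Comp S (λ s → chk (c s) (K s))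
    chkᶜ C K = ⟪ const′ 2 , ⟪ C , K ⟫ᶜ ⟫ᶜ

    pushᶜ : ∀ f {p K : Fn} → Comp S p → Comp S K → Comp S (λ s → push f (p s) (K s))
    pushᶜ f P K = ⟪ ⟪ const′ f , P ⟫ᶜ , K ⟫ᶜ

  abstract
    stepᶜ : ∀ {χ} → Comp S χ → Comp S (step χ)
    stepᶜ {χ} X = pickᶜ left′
      ( runOpᶜ (lᶜ (lᶜ (lᶜ right′))) (rᶜ (lᶜ (lᶜ right′))) (rᶜ (lᶜ right′)) (rᶜ right′)
      ∷ retFrameᶜ (lᶜ (lᶜ (rᶜ right′))) (rᶜ (lᶜ (rᶜ right′))) (lᶜ right′) (rᶜ (rᶜ right′))
      ∷ chkOpᶜ (lᶜ (lᶜ right′)) (rᶜ (lᶜ right′)) (rᶜ right′)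
      ∷ []) id′
      where
      chkOpᶜ : ∀ {op arg K : Fn} → Comp S op → Comp S arg → Comp S K →
               Comp S (λ s → chkOp (op s) (arg s) (K s))
      chkOpᶜ {arg = arg} {k} Op Arg K =
        pickᶜ Op (leaf ∷ leaf ∷ leaf ∷ leaf ∷ leaf ∷ node ∷ node ∷ node ∷ chkᶜ Arg K ∷ []) (const′ stuck)
        where
        leaf : Comp S (λ s → ifz (arg s) (ret 0 (k s)) stuck)
        leaf = ifzᶜ Arg (retᶜ (const′ 0) K) (const′ stuck)
        node : Comp S (λ s → chk (left (arg s)) (push 5 (right (arg s)) (k s)))
        node = chkᶜ (lᶜ Arg) (pushᶜ 5 (rᶜ Arg) K)

      retFrameᶜ : ∀ {f p v K : Fn} → Comp S f → Comp S p → Comp S v → Comp S K →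
                  Comp S (λ s → retFrame (f s) (p s) (v s) (K s))
      retFrameᶜ {f} {p} {v} F P V K = pickᶜ F
        ( runᶜ (lᶜ P) (rᶜ P) (pushᶜ 1 V K)
        ∷ retᶜ ⟪ P , V ⟫ᶜ K
        ∷ runᶜ P V K
        ∷ runᶜ (lᶜ P) ⟪ lᶜ (rᶜ P) , ⟪ rᶜ (rᶜ P) , V ⟫ᶜ ⟫ᶜ K
        ∷ ifzᶜ V (retᶜ (rᶜ (rᶜ P)) K) (runᶜ (lᶜ P) P⁺ (pushᶜ 4 ⟪ lᶜ P , P⁺ ⟫ᶜ K))
        ∷ chkᶜ P K
        ∷ runᶜ (lᶜ P) (rᶜ P) K
        ∷ const′ done
        ∷ []) (const′ stuck)
        where
        P⁺ : Comp S (λ s → ⟪ left (right (p s)) , suc (right (right (p s))) ⟫)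
        P⁺ = ⟪ lᶜ (rᶜ P) , sucᶜ (rᶜ (rᶜ P)) ⟫ᶜ

      runOpᶜ : ∀ {op arg n K : Fn} → Comp S op → Comp S arg → Comp S n → Comp S K →
               Comp S (λ s → runOp χ (op s) (arg s) (n s) (K s))
      runOpᶜ {n = n} Op Arg N K = pickᶜ Op
        ( retᶜ (const′ 0) K
        ∷ retᶜ (sucᶜ N) K
        ∷ retᶜ (lᶜ N) K
        ∷ retᶜ (rᶜ N) K
        ∷ retᶜ (X ∘ᶜ N) K
        ∷ runᶜ (lᶜ Arg) N (pushᶜ 0 ⟪ rᶜ Arg , N ⟫ᶜ K)
        ∷ runᶜ (rᶜ Arg) N (pushᶜ 2 (lᶜ Arg) K)
        ∷ ifzᶜ (rᶜ N) (runᶜ (lᶜ Arg) (lᶜ N) K)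
            (runᶜ ⟪ Op , Arg ⟫ᶜ N⁻ (pushᶜ 3 ⟪ rᶜ Arg , N⁻ ⟫ᶜ K))
        ∷ runᶜ Arg ⟪ N , const′ 0 ⟫ᶜ (pushᶜ 4 ⟪ Arg , ⟪ N , const′ 0 ⟫ᶜ ⟫ᶜ K)
        ∷ []) (const′ stuck)
        where
        N⁻ : Comp S (λ s → ⟪ left (n s) , pred (right (n s)) ⟫)
        N⁻ = ⟪ lᶜ N , predᶜ (rᶜ N) ⟫ᶜ

Halted : ℕ → Set
Halted s = left s ≡ 4

opaque
  unfolding run

  halted-done : Halted done
  halted-done = left-⟪⟫ 4 0

-- Correctness of the stack machine

module Machine (χ : ℕ → ℕ) where

  infix 4 _↦_ _↦*_

  -- Since halted states are excluded, a halting time of `s` is positive and `advance` can take one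
  -- step off it.
  record _↦_ (s s′ : ℕ) : Set where
    constructor move
    field
      running : ¬ Halted s
      step-≡  : step χ s ≡ s′

  private
    step-mode : ∀ s k → left s ≡ k → k ≢ 4 → s ↦ pick k (modes χ s) s
    step-mode s k p k≢4 = move (λ h → k≢4 (trans (sym p) h)) (cong (λ k → pick k (modes χ s) s) p)

    step-run : ∀ s {op arg n K} → left s ≡ 0 →
               left (left (left (right s))) ≡ op → right (left (left (right s))) ≡ arg →
               right (left (right s)) ≡ n → right (right s) ≡ K →
               s ↦ runOp χ op arg n K
    step-run s p refl refl refl refl = step-mode s 0 p λ ()

    step-ret : ∀ s {f p v K} → left s ≡ 1 →
               left (left (right (right s))) ≡ f → right (left (right (right s))) ≡ p →
               left (right s) ≡ v → right (right (right s)) ≡ K →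
               s ↦ retFrame f p v K
    step-ret s p refl refl refl refl = step-mode s 1 p λ ()

    step-chk : ∀ s {op arg K} → left s ≡ 2 →
               left (left (right s)) ≡ op → right (left (right s)) ≡ arg → right (right s) ≡ K →
               s ↦ chkOp op arg K
    step-chk s p refl refl refl = step-mode s 2 p λ ()

    step-stuck : ∀ s → left s ≡ 3 → s ↦ s
    step-stuck s p = step-mode s 3 p λ ()

    left² : ∀ a b c → left (left ⟪ ⟪ a , b ⟫ , c ⟫) ≡ a
    left² a b c = trans (cong left (left-⟪⟫ ⟪ a , b ⟫ c)) (left-⟪⟫ a b)

    rightleft : ∀ a b c → right (left ⟪ ⟪ a , b ⟫ , c ⟫) ≡ b
    rightleft a b c = trans (cong right (left-⟪⟫ ⟪ a , b ⟫ c)) (right-⟪⟫ a b)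

  step-halted : ∀ s → Halted s → step χ s ≡ s
  step-halted s h = cong (λ k → pick k (modes χ s) s) h

  opaque
    unfolding run

    left-run : ∀ c n K → left (run c n K) ≡ 0
    left-run c n K = left-⟪⟫ 0 ⟪ ⟪ c , n ⟫ , K ⟫

    right-run : ∀ c n K → right (run c n K) ≡ ⟪ ⟪ c , n ⟫ , K ⟫
    right-run c n K = right-⟪⟫ 0 ⟪ ⟪ c , n ⟫ , K ⟫

    left-ret : ∀ v K → left (ret v K) ≡ 1
    left-ret v K = left-⟪⟫ 1 ⟪ v , K ⟫

    right-ret : ∀ v K → right (ret v K) ≡ ⟪ v , K ⟫
    right-ret v K = right-⟪⟫ 1 ⟪ v , K ⟫

    left-chk : ∀ c K → left (chk c K) ≡ 2
    left-chk c K = left-⟪⟫ 2 ⟪ c , K ⟫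

    right-chk : ∀ c K → right (chk c K) ≡ ⟪ c , K ⟫
    right-chk c K = right-⟪⟫ 2 ⟪ c , K ⟫

    left-push : ∀ f p K → left (push f p K) ≡ ⟪ f , p ⟫
    left-push f p K = left-⟪⟫ ⟪ f , p ⟫ K

    right-push : ∀ f p K → right (push f p K) ≡ K
    right-push f p K = right-⟪⟫ ⟪ f , p ⟫ K

    left-stuck : left stuck ≡ 3
    left-stuck = left-⟪⟫ 3 0

  private
    lift₁ : ∀ {x y z} (f : ℕ → ℕ) → x ≡ y → f y ≡ z → f x ≡ z
    lift₁ f refl q = q

  ↦-run : ∀ op arg n K → run ⟪ op , arg ⟫ n K ↦ runOp χ op arg n K
  ↦-run op arg n K = go ⟪ op , arg ⟫ (left-⟪⟫ op arg) (right-⟪⟫ op arg)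
    where
    go : ∀ c → left c ≡ op → right c ≡ arg → run c n K ↦ runOp χ op arg n K
    go c p q = step-run (run c n K) (left-run c n K)
      (lift₁ (λ x → left (left (left x))) (right-run c n K)
        (lift₁ left (left² c n K) p))
      (lift₁ (λ x → right (left (left x))) (right-run c n K)
        (lift₁ right (left² c n K) q))
      (lift₁ (λ x → right (left x)) (right-run c n K) (rightleft c n K))
      (lift₁ right (right-run c n K) (right-⟪⟫ ⟪ c , n ⟫ K))

  ↦-ret : ∀ v f p K → ret v (push f p K) ↦ retFrame f p v K
  ↦-ret v f p K = go (push f p K) (left-push f p K) (right-push f p K)
    where
    go : ∀ k → left k ≡ ⟪ f , p ⟫ → right k ≡ K → ret v k ↦ retFrame f p v K
    go k q r = step-ret (ret v k) (left-ret v k)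
      (lift₁ (λ x → left (left (right x))) e (lift₁ (λ x → left (left x)) e′ (lift₁ left q (left-⟪⟫ f p))))
      (lift₁ (λ x → right (left (right x))) e (lift₁ (λ x → right (left x)) e′ (lift₁ right q (right-⟪⟫ f p))))
      (lift₁ left e (left-⟪⟫ v k))
      (lift₁ (λ x → right (right x)) e (lift₁ right e′ r))
      where
      e  = right-ret v k
      e′ = right-⟪⟫ v k

  ↦-chk : ∀ op arg K → chk ⟪ op , arg ⟫ K ↦ chkOp op arg K
  ↦-chk op arg K = go ⟪ op , arg ⟫ (left-⟪⟫ op arg) (right-⟪⟫ op arg)
    where
    go : ∀ c → left c ≡ op → right c ≡ arg → chk c K ↦ chkOp op arg K
    go c p q = step-chk (chk c K) (left-chk c K)
      (lift₁ (λ x → left (left x)) (right-chk c K) (lift₁ left (left-⟪⟫ c K) p))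
      (lift₁ (λ x → right (left x)) (right-chk c K) (lift₁ right (left-⟪⟫ c K) q))
      (lift₁ right (right-chk c K) (right-⟪⟫ c K))

  stuck↦stuck : stuck ↦ stuck
  stuck↦stuck = step-stuck stuck left-stuck

  private
    ↦-≡ : ∀ {s a b} → s ↦ a → a ≡ b → s ↦ b
    ↦-≡ (move ¬h p) q = move ¬h (trans p q)

  ↦-pair : ∀ c d n K → run ⟪ 5 , ⟪ c , d ⟫ ⟫ n K ↦ run c n (push 0 ⟪ d , n ⟫ K)
  ↦-pair c d n K = ↦-≡ (↦-run 5 ⟪ c , d ⟫ n K)
    (cong₂ (λ x y → run x n (push 0 ⟪ y , n ⟫ K)) (left-⟪⟫ c d) (right-⟪⟫ c d))

  ↦-pair₁ : ∀ d n x K → ret x (push 0 ⟪ d , n ⟫ K) ↦ run d n (push 1 x K)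
  ↦-pair₁ d n x K = ↦-≡ (↦-ret x 0 ⟪ d , n ⟫ K)
    (cong₂ (λ y z → run y z (push 1 x K)) (left-⟪⟫ d n) (right-⟪⟫ d n))

  ↦-comp : ∀ c d n K → run ⟪ 6 , ⟪ c , d ⟫ ⟫ n K ↦ run d n (push 2 c K)
  ↦-comp c d n K = ↦-≡ (↦-run 6 ⟪ c , d ⟫ n K)
    (cong₂ (λ x y → run y n (push 2 x K)) (left-⟪⟫ c d) (right-⟪⟫ c d))

  ↦-prec₀ : ∀ c d n K → run ⟪ 7 , ⟪ c , d ⟫ ⟫ ⟪ n , 0 ⟫ K ↦ run c n K
  ↦-prec₀ c d n K = go ⟪ n , 0 ⟫ ⟪ c , d ⟫ (left-⟪⟫ n 0) (right-⟪⟫ n 0) (left-⟪⟫ c d)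
    where
    go : ∀ x y → left x ≡ n → right x ≡ 0 → left y ≡ c → run ⟪ 7 , y ⟫ x K ↦ run c n K
    go x y p q r = ↦-≡ (↦-run 7 y x K)
      (trans (ifz-zero q) (cong₂ (λ x y → run x y K) r p))

  ↦-precₛ : ∀ c d n k K → run ⟪ 7 , ⟪ c , d ⟫ ⟫ ⟪ n , suc k ⟫ K ↦
            run ⟪ 7 , ⟪ c , d ⟫ ⟫ ⟪ n , k ⟫ (push 3 ⟪ d , ⟪ n , k ⟫ ⟫ K)
  ↦-precₛ c d n k K =
    go ⟪ n , suc k ⟫ ⟪ c , d ⟫ (left-⟪⟫ n (suc k)) (right-⟪⟫ n (suc k)) (right-⟪⟫ c d)
    where
    go : ∀ x y → left x ≡ n → right x ≡ suc k → right y ≡ d →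
         run ⟪ 7 , y ⟫ x K ↦ run ⟪ 7 , y ⟫ ⟪ n , k ⟫ (push 3 ⟪ d , ⟪ n , k ⟫ ⟫ K)
    go x y p q r = ↦-≡ (↦-run 7 y x K)
      (trans (ifz-nonzero (λ z → 1+n≢0 (trans (sym q) z)))
        (cong₂ (λ x d → run ⟪ 7 , y ⟫ x (push 3 ⟪ d , x ⟫ K))
               (cong₂ (λ n k → ⟪ n , pred k ⟫) p q) r))

  private
    frame³ : ∀ a b c (f : ℕ → ℕ → ℕ → ℕ) →
             f (left ⟪ a , ⟪ b , c ⟫ ⟫) (left (right ⟪ a , ⟪ b , c ⟫ ⟫)) (right (right ⟪ a , ⟪ b , c ⟫ ⟫)) ≡ f a b c
    frame³ a b c f = trans
      (cong₂ (λ x y → f x (left y) (right y)) (left-⟪⟫ a ⟪ b , c ⟫) (right-⟪⟫ a ⟪ b , c ⟫))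
      (cong₂ (f a) (left-⟪⟫ b c) (right-⟪⟫ b c))

  ↦-prec₁ : ∀ d n k x K → ret x (push 3 ⟪ d , ⟪ n , k ⟫ ⟫ K) ↦ run d ⟪ n , ⟪ k , x ⟫ ⟫ K
  ↦-prec₁ d n k x K = ↦-≡ (↦-ret x 3 ⟪ d , ⟪ n , k ⟫ ⟫ K)
    (frame³ d n k (λ d n k → run d ⟪ n , ⟪ k , x ⟫ ⟫ K))

  ↦-mu₀ : ∀ c n k K → ret 0 (push 4 ⟪ c , ⟪ n , k ⟫ ⟫ K) ↦ ret k K
  ↦-mu₀ c n k K = ↦-≡ (↦-ret 0 4 ⟪ c , ⟪ n , k ⟫ ⟫ K) (frame³ c n k (λ c n k → ret k K))

  ↦-muₛ : ∀ c n k v K → ret (suc v) (push 4 ⟪ c , ⟪ n , k ⟫ ⟫ K) ↦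
          run c ⟪ n , suc k ⟫ (push 4 ⟪ c , ⟪ n , suc k ⟫ ⟫ K)
  ↦-muₛ c n k v K = ↦-≡ (↦-ret (suc v) 4 ⟪ c , ⟪ n , k ⟫ ⟫ K)
    (frame³ c n k (λ c n k → run c ⟪ n , suc k ⟫ (push 4 ⟪ c , ⟪ n , suc k ⟫ ⟫ K)))

  ↦-start : ∀ v c n K → ret v (push 6 ⟪ c , n ⟫ K) ↦ run c n K
  ↦-start v c n K = ↦-≡ (↦-ret v 6 ⟪ c , n ⟫ K)
    (cong₂ (λ x y → run x y K) (left-⟪⟫ c n) (right-⟪⟫ c n))

  chkOp-node : ∀ {op} c d K → op ≡ 5 ⊎ op ≡ 6 ⊎ op ≡ 7 →
               chk ⟪ op , ⟪ c , d ⟫ ⟫ K ↦ chk c (push 5 d K)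
  chkOp-node {op} c d K o = ↦-≡ (↦-chk op ⟪ c , d ⟫ K) (trans (node o)
    (cong₂ (λ x y → chk x (push 5 y K)) (left-⟪⟫ c d) (right-⟪⟫ c d)))
    where
    node : ∀ {op arg} → op ≡ 5 ⊎ op ≡ 6 ⊎ op ≡ 7 →
           chkOp op arg K ≡ chk (left arg) (push 5 (right arg) K)
    node (inj₁ refl)        = refl
    node (inj₂ (inj₁ refl)) = refl
    node (inj₂ (inj₂ refl)) = refl

  data _↦*_ (s : ℕ) : ℕ → Set where
    ε   : s ↦* s
    _◅_ : ∀ {s′ s″} → s ↦ s′ → s′ ↦* s″ → s ↦* s″

  infixr 5 _◅_ _◅◅_

  _◅◅_ : ∀ {s s′ s″} → s ↦* s′ → s′ ↦* s″ → s ↦* s″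
  ε        ◅◅ q = q
  (r ◅ p) ◅◅ q = r ◅ (p ◅◅ q)

  record HaltsIn (t s : ℕ) : Set where
    constructor halts
    field
      halted : Halted (iter (step χ) t s)

  halts-back : ∀ {s s′} → s ↦* s′ → ∀ {t} → HaltsIn t s′ → ∃[ u ] HaltsIn u s
  halts-back ε h = _ , h
  halts-back {s} (move _ refl ◅ p) h with halts-back p h
  ... | u , halts h′ = suc u , halts (trans (cong left (sym (iter-comm (step χ) u s))) h′)

  advance : ∀ {s s′ t} → s ↦ s′ → HaltsIn t s → ∃[ u ] t ≡ suc u × HaltsIn u s′
  advance {t = zero}      (move ¬h refl) (halts h) = ⊥-elim (¬h h)
  advance {s} {t = suc t} (move ¬h refl) (halts h) =
    t , refl , halts (trans (cong left (iter-comm (step χ) t s)) h)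

  halts-suc : ∀ {t s} → HaltsIn t s → HaltsIn (suc t) s
  halts-suc {t} {s} (halts h) = halts (trans (cong left (step-halted (iter (step χ) t s) h)) h)

  halts-mono : ∀ {t u s} → t ≤ u → HaltsIn t s → HaltsIn u s
  halts-mono t≤u h = go (≤⇒≤′ t≤u) h
    where
    go : ∀ {t u s} → t ≤′ u → HaltsIn t s → HaltsIn u s
    go ≤′-refl       h = h
    go (≤′-step t≤u) h = halts-suc (go t≤u h)

  ¬halts-stuck : ∀ t → ¬ HaltsIn t stuck
  ¬halts-stuck zero    h with () ← advance stuck↦stuck h
  ¬halts-stuck (suc t) h with advance stuck↦stuck h
  ... | _ , refl , h′ = ¬halts-stuck t h′

  halts-done : HaltsIn 0 done
  halts-done = halts halted-done

  private
    by : ∀ {t u} → t ≡ suc u → u < t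
    by refl = ≤-refl

    Returns : ℕ → ℕ → ℕ → Set
    Returns t v K = ∃[ u ] u < t × HaltsIn u (ret v K)

    weaken : ∀ {t u v K} → u < t → Returns u v K → Returns t v K
    weaken u<t (w , w<u , h) = w , <-trans w<u u<t , h

  chk-complete : ∀ c K → chk (gödel c) K ↦* ret 0 K
  chk-complete zeroᶜ       K = ↦-chk 0 0 K ◅ ε
  chk-complete succᶜ       K = ↦-chk 1 0 K ◅ ε
  chk-complete leftᶜ       K = ↦-chk 2 0 K ◅ ε
  chk-complete rightᶜ      K = ↦-chk 3 0 K ◅ ε
  chk-complete oracleᶜ     K = ↦-chk 4 0 K ◅ ε
  chk-complete (pairᶜ c d) K = chkOp-node (gödel c) (gödel d) K (inj₁ refl) ◅
    chk-complete c _ ◅◅ ↦-ret 0 5 (gödel d) K ◅ chk-complete d K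
  chk-complete (compᶜ c d) K = chkOp-node (gödel c) (gödel d) K (inj₂ (inj₁ refl)) ◅
    chk-complete c _ ◅◅ ↦-ret 0 5 (gödel d) K ◅ chk-complete d K
  chk-complete (precᶜ c d) K = chkOp-node (gödel c) (gödel d) K (inj₂ (inj₂ refl)) ◅
    chk-complete c _ ◅◅ ↦-ret 0 5 (gödel d) K ◅ chk-complete d K
  chk-complete (muᶜ c)     K = ↦-chk 8 (gödel c) K ◅ chk-complete c K

  private
    Valid : ℕ → ℕ → ℕ → Set
    Valid t e K = ∃[ c ] gödel c ≡ e × Returns t 0 K

    leaf-sound : ∀ {t} op c → gödel c ≡ ⟪ op , 0 ⟫ →
                 (∀ arg K → chk ⟪ op , arg ⟫ K ↦ ifz arg (ret 0 K) stuck) →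
                 ∀ arg K → HaltsIn t (chk ⟪ op , arg ⟫ K) → Valid t ⟪ op , arg ⟫ K
    leaf-sound op c eq r arg K h with advance (r arg K) h
    leaf-sound op c eq r zero    K h | u , t≡ , h′ = c , eq , u , by t≡ , h′
    leaf-sound op c eq r (suc _) K h | u , t≡ , h′ = ⊥-elim (¬halts-stuck u h′)

    -- The second half of a check starts only when the first has returned. Its halting time must
    -- then be smaller for the recursion to go on, which is why the strict decrease is part of
    -- `Valid`.
    chk-sound-acc : ∀ {t} → Acc _<_ t → ∀ e K → HaltsIn t (chk e K) → Valid t e K

    node-sound : ∀ {t} → Acc _<_ t → ∀ op (con : Code → Code → Code) →
                 (∀ c d → gödel (con c d) ≡ ⟪ op , ⟪ gödel c , gödel d ⟫ ⟫) →
                 op ≡ 5 ⊎ op ≡ 6 ⊎ op ≡ 7 →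
                 ∀ e d K → HaltsIn t (chk ⟪ op , ⟪ e , d ⟫ ⟫ K) → Valid t ⟪ op , ⟪ e , d ⟫ ⟫ K

    op-sound : ∀ {t} → Acc _<_ t → ∀ op arg K →
               HaltsIn t (chk ⟪ op , arg ⟫ K) → Valid t ⟪ op , arg ⟫ K

    chk-sound-acc a e K h =
      subst (λ e → HaltsIn _ (chk e K) → Valid _ e K) (⟪left,right⟫ e)
        (op-sound a (left e) (right e) K) h

    node-sound (acc rs) op con eq o e d K h with advance (chkOp-node e d K o) h
    ... | t₁ , p₁ , h₁ with chk-sound-acc (rs (by p₁)) e (push 5 d K) h₁
    ... | c , refl , t₂ , p₂ , h₂ with advance (↦-ret 0 5 d K) h₂
    ... | t₃ , p₃ , h₃ with <-trans (by p₃) (<-trans p₂ (by p₁))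
    ... | p with chk-sound-acc (rs p) d K h₃
    ... | c′ , refl , r = con c c′ , eq c c′ , weaken p r

    op-sound a 0 arg K h = leaf-sound 0 zeroᶜ   refl (↦-chk 0) arg K h
    op-sound a 1 arg K h = leaf-sound 1 succᶜ   refl (↦-chk 1) arg K h
    op-sound a 2 arg K h = leaf-sound 2 leftᶜ   refl (↦-chk 2) arg K h
    op-sound a 3 arg K h = leaf-sound 3 rightᶜ  refl (↦-chk 3) arg K h
    op-sound a 4 arg K h = leaf-sound 4 oracleᶜ refl (↦-chk 4) arg K h
    op-sound a 5 arg K h =
      subst (λ arg → HaltsIn _ (chk ⟪ 5 , arg ⟫ K) → Valid _ ⟪ 5 , arg ⟫ K) (⟪left,right⟫ arg)
        (node-sound a 5 pairᶜ (λ _ _ → refl) (inj₁ refl) (left arg) (right arg) K) h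
    op-sound a 6 arg K h =
      subst (λ arg → HaltsIn _ (chk ⟪ 6 , arg ⟫ K) → Valid _ ⟪ 6 , arg ⟫ K) (⟪left,right⟫ arg)
        (node-sound a 6 compᶜ (λ _ _ → refl) (inj₂ (inj₁ refl)) (left arg) (right arg) K) h
    op-sound a 7 arg K h =
      subst (λ arg → HaltsIn _ (chk ⟪ 7 , arg ⟫ K) → Valid _ ⟪ 7 , arg ⟫ K) (⟪left,right⟫ arg)
        (node-sound a 7 precᶜ (λ _ _ → refl) (inj₂ (inj₂ refl)) (left arg) (right arg) K) h
    op-sound (acc rs) 8 arg K h with advance (↦-chk 8 arg K) h
    ... | t₁ , p₁ , h₁ with chk-sound-acc (rs (by p₁)) arg K h₁
    ... | c , refl , r = muᶜ c , refl , weaken (by p₁) r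
    op-sound a op@(suc (suc (suc (suc (suc (suc (suc (suc (suc _))))))))) arg K h
      with advance (↦-chk op arg K) h
    ... | t₁ , _ , h₁ = ⊥-elim (¬halts-stuck t₁ h₁)

  abstract
    chk-sound : ∀ {t} e K → HaltsIn t (chk e K) →
                ∃[ c ] gödel c ≡ e × ∃[ u ] u < t × HaltsIn u (ret 0 K)
    chk-sound = chk-sound-acc (<-wellFounded _)

  module _ {P : Pred ℕ 0ℓ} (oracle : ∀ n → Eval P oracleᶜ n (χ n)) where

    private
      -- The induction is on d, the number of failing arguments still ahead of the zero at k.
      mu-complete : ∀ c n k K → (∀ L → run c ⟪ n , k ⟫ L ↦* ret 0 L) →
                    (∀ j → j < k → ∃[ v ] ∀ L → run c ⟪ n , j ⟫ L ↦* ret (suc v) L) →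
                    ∀ d j → j + d ≡ k → run c ⟪ n , j ⟫ (push 4 ⟪ c , ⟪ n , j ⟫ ⟫ K) ↦* ret k K
      mu-complete c n k K z s zero    j eq with trans (sym (+-identityʳ j)) eq
      ... | refl = z _ ◅◅ ↦-mu₀ c n k K ◅ ε
      mu-complete c n k K z s (suc d) j eq with s j (m+n≤o⇒m≤o (suc j) (≤-reflexive (trans (sym (+-suc j d)) eq)))
      ... | v , r = r _ ◅◅ ↦-muₛ c n j v K ◅
        mu-complete c n k K z s d (suc j) (trans (sym (+-suc j d)) eq)

    run-complete : ∀ {c n m} → Eval P c n m → ∀ K → run (gödel c) n K ↦* ret m K
    run-complete {n = n} e-zero K = ↦-run 0 0 n K ◅ ε
    run-complete {n = n} e-succ K = ↦-run 1 0 n K ◅ ε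
    run-complete (e-left {m} {n}) K =
      ↦-≡ (↦-run 2 0 ⟪ m , n ⟫ K) (cong (λ x → ret x K) (left-⟪⟫ m n)) ◅ ε
    run-complete (e-right {m} {n}) K =
      ↦-≡ (↦-run 3 0 ⟪ m , n ⟫ K) (cong (λ x → ret x K) (right-⟪⟫ m n)) ◅ ε
    run-complete {n = n} (e-yes p) K =
      ↦-≡ (↦-run 4 0 n K) (cong (λ x → ret x K) (eval-deterministic (oracle n) (e-yes p))) ◅ ε
    run-complete {n = n} (e-no p) K =
      ↦-≡ (↦-run 4 0 n K) (cong (λ x → ret x K) (eval-deterministic (oracle n) (e-no p))) ◅ ε
    run-complete (e-pair {c} {d} {n} {x} {y} p q) K =
      ↦-pair (gödel c) (gödel d) n K ◅ run-complete p _ ◅◅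
      ↦-pair₁ (gödel d) n x K ◅ run-complete q _ ◅◅ ↦-ret y 1 x K ◅ ε
    run-complete (e-comp {c} {d} {n} {x} {y} p q) K =
      ↦-comp (gödel c) (gödel d) n K ◅ run-complete p _ ◅◅
      ↦-ret x 2 (gödel c) K ◅ run-complete q K
    run-complete (e-prec₀ {c} {d} {n} p) K =
      ↦-prec₀ (gödel c) (gödel d) n K ◅ run-complete p K
    run-complete (e-precₛ {c} {d} {n} {k} {x} p q) K =
      ↦-precₛ (gödel c) (gödel d) n k K ◅ run-complete p _ ◅◅
      ↦-prec₁ (gödel d) n k x K ◅ run-complete q K
    run-complete (e-mu {c} {n} {k} p f) K = ↦-run 8 (gödel c) n K ◅
      mu-complete (gödel c) n k K (run-complete p)
        (λ j j<k → let (v , e) = f j j<k in v , run-complete e) k 0 refl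

    private
      Evaluates : ℕ → Code → ℕ → ℕ → Set
      Evaluates t c n K = ∃[ m ] Eval P c n m × Returns t m K

      -- Completeness follows the derivation, soundness the clock: a minimisation runs the same
      -- program again at a larger argument, so the halting time is the quantity that decreases.
      run-sound-acc : ∀ {t} → Acc _<_ t → ∀ c n K → HaltsIn t (run (gödel c) n K) → Evaluates t c n K

      mu-sound : ∀ {t} → Acc _<_ t → ∀ c n k K →
                 (∀ j → j < k → ∃ λ v → Eval P c ⟪ n , j ⟫ (suc v)) →
                 HaltsIn t (run (gödel c) ⟪ n , k ⟫ (push 4 ⟪ gödel c , ⟪ n , k ⟫ ⟫ K)) →
                 Evaluates t (muᶜ c) n K

      prec-sound : ∀ {t} → Acc _<_ t → ∀ c d n k K →
                   HaltsIn t (run (gödel (precᶜ c d)) ⟪ n , k ⟫ K) →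
                   Evaluates t (precᶜ c d) ⟪ n , k ⟫ K

      run-sound-acc a zeroᶜ n K h with advance (↦-run 0 0 n K) h
      ... | u , p , h′ = 0 , e-zero , u , by p , h′
      run-sound-acc a succᶜ n K h with advance (↦-run 1 0 n K) h
      ... | u , p , h′ = suc n , e-succ , u , by p , h′
      run-sound-acc a leftᶜ n K h with advance (↦-run 2 0 n K) h
      ... | u , p , h′ = left n ,
        subst (λ k → Eval P leftᶜ k (left n)) (⟪left,right⟫ n) (e-left {m = left n} {right n}) , u , by p , h′
      run-sound-acc a rightᶜ n K h with advance (↦-run 3 0 n K) h
      ... | u , p , h′ = right n ,
        subst (λ k → Eval P rightᶜ k (right n)) (⟪left,right⟫ n) (e-right {m = left n} {right n}) , u , by p , h′
      run-sound-acc a oracleᶜ n K h with advance (↦-run 4 0 n K) h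
      ... | u , p , h′ = χ n , oracle n , u , by p , h′
      run-sound-acc (acc rs) (pairᶜ c d) n K h with advance (↦-pair (gödel c) (gödel d) n K) h
      ... | t₁ , p₁ , h₁ with run-sound-acc (rs (by p₁)) c n _ h₁
      ... | x , e , t₂ , p₂ , h₂ with advance (↦-pair₁ (gödel d) n x K) h₂
      ... | t₃ , p₃ , h₃ with <-trans (by p₃) (<-trans p₂ (by p₁))
      ... | q with run-sound-acc (rs q) d n _ h₃
      ... | y , e′ , t₄ , p₄ , h₄ with advance (↦-ret y 1 x K) h₄
      ... | t₅ , p₅ , h₅ = ⟪ x , y ⟫ , e-pair e e′ , t₅ , <-trans (by p₅) (<-trans p₄ q) , h₅
      run-sound-acc (acc rs) (compᶜ c d) n K h with advance (↦-comp (gödel c) (gödel d) n K) h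
      ... | t₁ , p₁ , h₁ with run-sound-acc (rs (by p₁)) d n _ h₁
      ... | x , e , t₂ , p₂ , h₂ with advance (↦-ret x 2 (gödel c) K) h₂
      ... | t₃ , p₃ , h₃ with <-trans (by p₃) (<-trans p₂ (by p₁))
      ... | q with run-sound-acc (rs q) c x K h₃
      ... | y , e′ , r = y , e-comp e e′ , weaken q r
      run-sound-acc a (precᶜ c d) n K h =
        subst (λ n → HaltsIn _ (run (gödel (precᶜ c d)) n K) → Evaluates _ (precᶜ c d) n K)
          (⟪left,right⟫ n) (prec-sound a c d (left n) (right n) K) h
      run-sound-acc (acc rs) (muᶜ c) n K h with advance (↦-run 8 (gödel c) n K) h
      ... | t₁ , p₁ , h₁ with mu-sound (rs (by p₁)) c n 0 K (λ _ ()) h₁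
      ... | m , e , r = m , e , weaken (by p₁) r

      prec-sound (acc rs) c d n zero K h with advance (↦-prec₀ (gödel c) (gödel d) n K) h
      ... | t₁ , p₁ , h₁ with run-sound-acc (rs (by p₁)) c n K h₁
      ... | m , e , r = m , e-prec₀ {n = n} e , weaken (by p₁) r
      prec-sound (acc rs) c d n (suc k) K h with advance (↦-precₛ (gödel c) (gödel d) n k K) h
      ... | t₁ , p₁ , h₁ with prec-sound (rs (by p₁)) c d n k _ h₁
      ... | x , e , t₂ , p₂ , h₂ with advance (↦-prec₁ (gödel d) n k x K) h₂
      ... | t₃ , p₃ , h₃ with <-trans (by p₃) (<-trans p₂ (by p₁))
      ... | q with run-sound-acc (rs q) d ⟪ n , ⟪ k , x ⟫ ⟫ K h₃
      ... | y , e′ , r = y , e-precₛ {n = n} {k = k} e e′ , weaken q r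

      mu-sound a@(acc rs) c n k K f h with run-sound-acc a c ⟪ n , k ⟫ _ h
      ... | zero  , e , t₁ , p₁ , h₁ with advance (↦-mu₀ (gödel c) n k K) h₁
      ...   | t₂ , p₂ , h₂ = k , e-mu e f , t₂ , <-trans (by p₂) p₁ , h₂
      mu-sound a@(acc rs) c n k K f h
          | suc v , e , t₁ , p₁ , h₁ with advance (↦-muₛ (gödel c) n k v K) h₁
      ...   | t₂ , p₂ , h₂ with <-trans (by p₂) p₁
      ...   | q with mu-sound (rs q) c n (suc k) K f⁺ h₂
        where
        f⁺ : ∀ j → j < suc k → ∃ λ v → Eval P c ⟪ n , j ⟫ (suc v)
        f⁺ j j<1+k with m<1+n⇒m<n∨m≡n j<1+k
        ... | inj₁ j<k  = f j j<k
        ... | inj₂ refl = v , e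
      ...   | m , e′ , r = m , e′ , weaken q r

    abstract
      run-sound : ∀ {t} c n K → HaltsIn t (run (gödel c) n K) →
                  ∃[ m ] Eval P c n m × ∃[ u ] u < t × HaltsIn u (ret m K)
      run-sound = run-sound-acc (<-wellFounded _)

-- Halting times

running : (ℕ → ℕ) → ℕ → ℕ → ℕ
running χ t s = dist (left (iter (step χ) t s)) 4

runningᶜ : ∀ {S χ t s} → Comp S χ → Comp S t → Comp S s →
           Comp S (λ n → running χ (t n) (s n))
runningᶜ X T S = distᶜ (lᶜ (iterᶜ (stepᶜ X) T S)) (const′ 4)

module _ (χ : ℕ → ℕ) where
  open Machine χ

  running≡0 : ∀ t {s} → running χ t s ≡ 0 → HaltsIn t s
  running≡0 t eq = halts (dist≡0 eq)

  halts⇒running≡0 : ∀ {t s} → HaltsIn t s → running χ t s ≡ 0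
  halts⇒running≡0 (halts h) = trans (cong (λ k → dist k 4) h) (dist-refl 4)

abstract
  bottom : ℕ
  bottom = push 7 0 0

  -- `start` accepts any number and checks it first; `enter` is for numbers already known to be
  -- programs. Frame 7 in `bottom` turns the return of a final value into halting.
  enter start : ℕ → ℕ → ℕ
  enter e n = run e n bottom
  start e n = chk e (push 6 ⟪ e , n ⟫ bottom)

  enterᶜ : ∀ {S e n} → Comp S e → Comp S n → Comp S (λ x → enter (e x) (n x))
  enterᶜ E N = runᶜ E N (const′ bottom)

  startᶜ : ∀ {S e n} → Comp S e → Comp S n → Comp S (λ x → start (e x) (n x))
  startᶜ E N = chkᶜ E (pushᶜ 6 ⟪ E , N ⟫ᶜ (const′ bottom))

  running-start : ∀ χ e n → running χ 0 (start e n) ≢ 0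
  running-start χ e n eq with () ← trans (sym (dist≡0 eq)) (Machine.left-chk χ e _)

module _ {P : Pred ℕ 0ℓ} {χ : ℕ → ℕ} (oracle : ∀ n → Eval P oracleᶜ n (χ n)) where
  open Machine χ

  abstract
    enter-complete : ∀ {c n m} → Eval P c n m → ∃[ t ] running χ t (enter (gödel c) n) ≡ 0
    enter-complete e with halts-back (run-complete oracle e _ ◅◅ ↦-ret _ 7 0 0 ◅ ε) halts-done
    ... | t , h = t , halts⇒running≡0 χ h

    enter-sound : ∀ t c n → running χ t (enter (gödel c) n) ≡ 0 → ∃ (Eval P c n)
    enter-sound t c n eq with run-sound oracle c n bottom (running≡0 χ t eq)
    ... | m , e , _ = m , e

    start-complete : ∀ {e n} → ∃ (φ P e n) → ∃[ t ] running χ t (start e n) ≡ 0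
    start-complete {n = n} (m , c , refl , e) with
      halts-back (chk-complete c _ ◅◅ ↦-start 0 (gödel c) n _ ◅
                  run-complete oracle e _ ◅◅ ↦-ret _ 7 0 0 ◅ ε) halts-done
    ... | t , h = t , halts⇒running≡0 χ h

    start-sound : ∀ t e n → running χ t (start e n) ≡ 0 → ∃ (φ P e n)
    start-sound t e n eq with chk-sound e (push 6 ⟪ e , n ⟫ bottom) (running≡0 χ t eq)
    ... | c , refl , u , _ , h with advance (↦-start 0 (gödel c) n bottom) h
    ... | _ , _ , h′ with run-sound oracle c n bottom h′
    ... | m , p , _ = m , c , refl , p

    running-mono : ∀ t u {s} → t ≤ u → running χ t s ≡ 0 → running χ u s ≡ 0
    running-mono t u t≤u eq = halts⇒running≡0 χ (halts-mono t≤u (running≡0 χ t eq))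

∅-oracle : ∀ n → Eval ∅ oracleᶜ n 0
∅-oracle n = e-no λ ()

opaque
  -- A Kleene predicate with 0 for truth: t steps suffice to check that e is a program and to run it
  -- on e. It is monotone in t, so every upper bound for the halting time can be used in place of
  -- the time itself.
  T : ℕ → ℕ → ℕ
  T e t = running (λ _ → 0) t (start e e)

  Tᶜ : ∀ {S e t} → Comp S e → Comp S t → Comp S (λ n → T (e n) (t n))
  Tᶜ E T = runningᶜ (const′ 0) T (startᶜ E E)

  T-mono : ∀ e t u → t ≤ u → T e t ≡ 0 → T e u ≡ 0
  T-mono e t u = running-mono ∅-oracle t u

  T-sound : ∀ e t → T e t ≡ 0 → e ∈ ∅′
  T-sound e t = start-sound ∅-oracle t e e

  T-0 : ∀ e → T e 0 ≢ 0
  T-0 e = running-start (λ _ → 0) e e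

  T-complete : ∀ {e} → e ∈ ∅′ → ∃[ t ] T e t ≡ 0
  T-complete e∈ = start-complete ∅-oracle e∈

-- As `pred 0` is 0, the two halves contradict each other at t = 0. No halting time is lost, since
-- start states are not halted, and `⟪ e , 0 ⟫` stays free for the first point of e.
ExactTime : ℕ → ℕ → Set
ExactTime e t = T e t ≡ 0 × T e (pred t) ≢ 0

exact-time : ∀ {e} → e ∈ ∅′ → ∃ (ExactTime e)
exact-time {e} e∈ with T-complete e∈
... | t , eq with least-zero (T e) t eq
... | zero  , eq₀ , _   = ⊥-elim (T-0 e eq₀)
... | suc l , eqₗ , pos = suc l , eqₗ , λ eq₀ → 1+n≢0 (trans (sym (proj₂ (pos l ≤-refl))) eq₀)

¬ExactTime-0 : ∀ {e} → ¬ ExactTime e 0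
¬ExactTime-0 (p , q) = q p

ExactTime-≤ : ∀ {e t u} → ExactTime e t → ExactTime e u → t ≤ u
ExactTime-≤ {e} {t} {u} (_ , q) (p , _) with t ≤? u
... | yes t≤u = t≤u
... | no  t≰u = ⊥-elim (q (T-mono e u (pred t) (pred-mono-≤ (≰⇒> t≰u)) p))

ExactTime-unique : ∀ {e t u} → ExactTime e t → ExactTime e u → t ≡ u
ExactTime-unique p q = ≤-antisym (ExactTime-≤ p q) (ExactTime-≤ q p)

opaque
  -- The points of M with att n = ⟪ e , 0 ⟫ are n = ⟪ e , 0 ⟫ itself and, if e halts
  -- on e, also n = ⟪ e , t ⟫ for the halting time t.
  att : ℕ → ℕ
  att n = ifz (T (left n) (right n)) (ifz (T (left n) (pred (right n))) n ⟪ left n , 0 ⟫) n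

  attᶜ : ∀ {S} → Comp S att
  attᶜ = ifzᶜ (Tᶜ left′ right′) (ifzᶜ (Tᶜ left′ (predᶜ right′)) id′ ⟪ left′ , const′ 0 ⟫ᶜ) id′

  att-cases : ∀ n e t → ifz (T e t) (ifz (T e (pred t)) n ⟪ e , 0 ⟫) n ≡ n ⊎
              ExactTime e t × ifz (T e t) (ifz (T e (pred t)) n ⟪ e , 0 ⟫) n ≡ ⟪ e , 0 ⟫
  att-cases n e t with T e t | T e (pred t)
  ... | suc _ | _     = inj₁ refl
  ... | zero  | zero  = inj₁ refl
  ... | zero  | suc _ = inj₂ ((refl , λ ()) , refl)

opaque
  unfolding att

  att-view : ∀ n → att n ≡ n ⊎ ∃[ e ] ∃[ t ] n ≡ ⟪ e , t ⟫ × ExactTime e t × att n ≡ ⟪ e , 0 ⟫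
  att-view n with att-cases n (left n) (right n)
  ... | inj₁ p       = inj₁ p
  ... | inj₂ (x , p) = inj₂ (left n , right n , sym (⟪left,right⟫ n) , x , p)

  att-exact : ∀ {e t} → ExactTime e t → att ⟪ e , t ⟫ ≡ ⟪ e , 0 ⟫
  att-exact {e} {t} (p , q) = go ⟪ e , t ⟫ (left-⟪⟫ e t) (right-⟪⟫ e t)
    where
    go : ∀ n → left n ≡ e → right n ≡ t → att n ≡ ⟪ e , 0 ⟫
    go n refl refl = trans (ifz-zero p) (ifz-nonzero q)

  att≤ : ∀ n → att n ≤ n
  att≤ n with att-view n
  ... | inj₁ p = ≤-reflexive p
  ... | inj₂ (e , t , p , _ , q) = subst (att n ≤_) (sym p)
    (≤-trans (≤-reflexive q) (⟪⟫-mono {e} {0} {e} {t} ≤-refl z≤n))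

  att-fixed : ∀ e → att ⟪ e , 0 ⟫ ≡ ⟪ e , 0 ⟫
  att-fixed e with att-view ⟪ e , 0 ⟫
  ... | inj₁ p = p
  ... | inj₂ (e′ , t , p , x , _) with ⟪⟫-injective e 0 e′ t p
  ... | refl , refl = ⊥-elim (¬ExactTime-0 x)

  att-preimage : ∀ {e t} → ExactTime e t → ∀ q → att q ≡ ⟪ e , 0 ⟫ → q ≡ ⟪ e , 0 ⟫ ⊎ q ≡ ⟪ e , t ⟫
  att-preimage {e} {t} x q eq with att-view q
  ... | inj₁ p = inj₁ (trans (sym p) eq)
  ... | inj₂ (e′ , t′ , p , x′ , r) with ⟪⟫-injective e′ 0 e 0 (trans (sym r) eq)
  ... | refl , _ = inj₂ (trans p (cong (λ t → ⟪ e , t ⟫) (ExactTime-unique x′ x)))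

module _ (em : ExcludedMiddle 0ℓ) where

  time-bound : ∀ e → ∃[ b ] ∀ t → ExactTime e t → t ≤ b
  time-bound e with em {∃ (ExactTime e)}
  ... | yes (b , x) = b , λ t y → ExactTime-≤ y x
  ... | no  ¬x      = 0 , λ t y → ⊥-elim (¬x (t , y))

  times-bound : ∀ N → ∃[ B ] ∀ e t → e < N → ExactTime e t → ⟪ e , t ⟫ ≤ B
  times-bound zero    = 0 , λ _ _ ()
  times-bound (suc N) with times-bound N | time-bound N
  ... | B , β | b , γ = B ⊔ ⟪ N , b ⟫ , bound
    where
    bound : ∀ e t → e < suc N → ExactTime e t → ⟪ e , t ⟫ ≤ B ⊔ ⟪ N , b ⟫
    bound e t e<1+N x with m<1+n⇒m<n∨m≡n e<1+N
    ... | inj₁ e<N  = ≤-trans (β e t e<N x) (m≤m⊔n B _)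
    ... | inj₂ refl = ≤-trans (⟪⟫-mono {e} {t} {e} {b} ≤-refl (γ t x)) (m≤n⊔m B _)

  -- If `att n` differs from n, then n is `⟪ e , t ⟫` with e at most `⟪ e , 0 ⟫`, hence at most N.
  -- This leaves finitely many e with one halting time each. B bounds these times, so it cannot be
  -- computable in N.
  att-finite-to-one : ∀ N → ∃[ B ] ∀ n → att n ≤ N → n ≤ B
  att-finite-to-one N with times-bound (suc N)
  ... | B , β = N ⊔ B , bound
    where
    bound : ∀ n → att n ≤ N → n ≤ N ⊔ B
    bound n att≤N with att-view n
    ... | inj₁ p = ≤-trans (≤-reflexive (sym p)) (≤-trans att≤N (m≤m⊔n N B))
    ... | inj₂ (e , t , p , x , q) = subst (_≤ N ⊔ B) (sym p) (≤-trans
      (β e t (s≤s (≤-trans (m≤⟪m,n⟫ e 0) (≤-trans (≤-reflexive (sym q)) att≤N))) x)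
      (m≤n⊔m N B))

-- Embeddings

module _ {L : Language} where
  open Language L

  private
    map-all : ∀ {A B : Structure L} (f : A ↪ B) {l} {v : Vec ℕ l} →
              Allᵛ (dom A) v → Allᵛ (dom B) (Vec.map (map-of f) v)
    map-all f p = Allᵛ-map⁺ (VecAll.map (into f) p)

  ↪-trans : ∀ {A B C : Structure L} → A ↪ B → B ↪ C → A ↪ C
  map-of    (↪-trans f g) = map-of g ∘ map-of f
  into      (↪-trans f g) = into g ∘ into f
  injective (↪-trans f g) x∈ y∈ eq = injective f x∈ y∈ (injective g (into f x∈) (into f y∈) eq)
  rel-⇔     (↪-trans {C = C} f g) {n} s {v} p
    rewrite VecProp.map-∘ (map-of g) (map-of f) v = mk⇔
      (to (rel-⇔ g s (map-all f p)) ∘ to (rel-⇔ f s p))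
      (from (rel-⇔ f s p) ∘ from (rel-⇔ g s (map-all f p)))
  fun-≡     (↪-trans f g) {m} s {v} p
    rewrite VecProp.map-∘ (map-of g) (map-of f) v =
      trans (cong (map-of g) (fun-≡ f s p)) (fun-≡ g s (map-all f p))

  ≅-refl : ∀ {A : Structure L} → A ≅ A
  ≅-refl {A} = record
    { map-of = id ; into = id ; injective = λ _ _ → id
    ; rel-⇔ = λ {n} _ {v} _ → subst (λ w → rel A n v ⇔ rel A n w) (sym (VecProp.map-id v)) (mk⇔ id id)
    ; fun-≡ = λ {m} _ {v} _ → cong (fun A m) (sym (VecProp.map-id v))
    } , λ {y} y∈ → y , y∈ , refl

  module _ (em : ExcludedMiddle 0ℓ) {A B : Structure L} (f : A ↪ B) (onto : Onto f) where

    private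
      -- The domain of B need not be decidable, so the decision comes from excluded middle; 0 is a
      -- filler outside the domain.
      inverse : ∀ {y} → Dec (dom B y) → ℕ
      inverse (yes y∈) = proj₁ (onto y∈)
      inverse (no _)   = 0

      inverse-∈ : ∀ {y} (d : Dec (dom B y)) → y ∈ dom B → inverse d ∈ dom A
      inverse-∈ (yes y∈) _  = proj₁ (proj₂ (onto y∈))
      inverse-∈ (no y∉)  y∈ = ⊥-elim (y∉ y∈)

      inverse-≡ : ∀ {y} (d : Dec (dom B y)) → y ∈ dom B → map-of f (inverse d) ≡ y
      inverse-≡ (yes y∈) _  = proj₂ (proj₂ (onto y∈))
      inverse-≡ (no y∉)  y∈ = ⊥-elim (y∉ y∈)

      f⁻¹ : ℕ → ℕ
      f⁻¹ y = inverse {y} em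

      f⁻¹-∈ : ∀ {y} → y ∈ dom B → f⁻¹ y ∈ dom A
      f⁻¹-∈ = inverse-∈ em

      f-f⁻¹ : ∀ {y} → y ∈ dom B → map-of f (f⁻¹ y) ≡ y
      f-f⁻¹ = inverse-≡ em

      f⁻¹-all : ∀ {l} {v : Vec ℕ l} → Allᵛ (dom B) v → Allᵛ (dom A) (Vec.map f⁻¹ v)
      f⁻¹-all p = Allᵛ-map⁺ (VecAll.map f⁻¹-∈ p)

      map-f-f⁻¹ : ∀ {l} {v : Vec ℕ l} → Allᵛ (dom B) v → Vec.map (map-of f) (Vec.map f⁻¹ v) ≡ v
      map-f-f⁻¹ []       = refl
      map-f-f⁻¹ (p ∷ ps) = cong₂ _∷_ (f-f⁻¹ p) (map-f-f⁻¹ ps)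

    ≅-inverse : B ↪ A
    map-of    ≅-inverse = f⁻¹
    into      ≅-inverse = f⁻¹-∈
    injective ≅-inverse x∈ y∈ eq = trans (sym (f-f⁻¹ x∈)) (trans (cong (map-of f) eq) (f-f⁻¹ y∈))
    rel-⇔     ≅-inverse {n} s {v} p = mk⇔
      (from (rel-⇔ f s (f⁻¹-all p)) ∘ subst (rel B n) (sym (map-f-f⁻¹ p)))
      (subst (rel B n) (map-f-f⁻¹ p) ∘ to (rel-⇔ f s (f⁻¹-all p)))
    fun-≡     ≅-inverse {m} s {v} p = injective f
      (f⁻¹-∈ (closed B s p)) (closed A s (f⁻¹-all p))
      (trans (f-f⁻¹ (closed B s p))
        (sym (trans (fun-≡ f s (f⁻¹-all p)) (cong (fun B m) (map-f-f⁻¹ p)))))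

-- The language of digraphs

digraph : Language
digraph = record
  { RelSym      = _≡ 0
  ; FunSym      = ∅
  ; arity       = λ _ → 2
  ; disjoint    = λ _ ()
  ; positive    = λ _ → s≤s z≤n
  ; RelSym-comp = gödel (code is-zero) , λ n →
      (λ { refl → code is-zero , refl , correct is-zero 0 }) ,
      (λ n≢0 → code is-zero , refl , subst (Eval ∅ _ n) (from not≡0 n≢0) (correct is-zero n))
  ; FunSym-comp = gödel zeroᶜ , λ n → (λ ()) , λ _ → zeroᶜ , refl , e-zero
  ; arity-comp  = gödel (code two) , λ n → code two , refl , correct two n
  }
  where
  is-zero : Comp ∅ not
  is-zero = ifzᶜ id′ (const′ 1) (const′ 0)

  two : Comp ∅ (λ _ → 2)
  two = const′ 2

edge : Structure digraph → ℕ → ℕ → Set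
edge A x y = rel A 0 (x ∷ y ∷ [])

module _ {A B : Structure digraph} where

  digraph-embedding :
    (f : ℕ → ℕ) → (∀ {x} → x ∈ dom A → f x ∈ dom B) →
    (∀ {x y} → x ∈ dom A → y ∈ dom A → f x ≡ f y → x ≡ y) →
    (∀ {x y} → x ∈ dom A → y ∈ dom A → edge A x y ⇔ edge B (f x) (f y)) → A ↪ B
  digraph-embedding f f-into f-inj f-edge = record
    { map-of = f ; into = f-into ; injective = f-inj
    ; rel-⇔ = λ { refl {x ∷ y ∷ []} (x∈ ∷ y∈ ∷ []) → f-edge x∈ y∈ }
    ; fun-≡ = λ ()
    }

  edge-⇔ : (f : A ↪ B) → ∀ {x y} → x ∈ dom A → y ∈ dom A →
           edge A x y ⇔ edge B (map-of f x) (map-of f y)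
  edge-⇔ f x∈ y∈ = rel-⇔ f refl (x∈ ∷ y∈ ∷ [])

Gen⁻ : ∀ {M : Structure digraph} {a x} → Gen M a x → x ∈ˡ a
Gen⁻ (gen x∈a) = x∈a
Gen⁻ (app () _)

-- Every number is a spine or a point, so that the universe of M is all of ω.
opaque
  spine point : ℕ → ℕ
  spine n = ⟪ 0 , n ⟫
  point n = ⟪ suc (left n) , right n ⟫

  spineᶜ : ∀ {S} → Comp S spine
  spineᶜ = ⟪ const′ 0 , id′ ⟫ᶜ

  pointᶜ : ∀ {S} → Comp S point
  pointᶜ = ⟪ sucᶜ left′ , right′ ⟫ᶜ

  spine-injective : ∀ {m n} → spine m ≡ spine n → m ≡ n
  spine-injective {m} {n} eq = proj₂ (⟪⟫-injective 0 m 0 n eq)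

  spine≢point : ∀ {m n} → spine m ≢ point n
  spine≢point {m} {n} eq with () ← proj₁ (⟪⟫-injective 0 m (suc (left n)) (right n) eq)

  n≤spine : ∀ n → n ≤ spine n
  n≤spine n = n≤⟪m,n⟫ 0 n

  n≤point : ∀ n → n ≤ point n
  n≤point n = subst (_≤ point n) (⟪left,right⟫ n)
    (⟪⟫-mono {left n} {right n} {suc (left n)} {right n} (n≤1+n _) ≤-refl)

  index-of : ℕ → ℕ
  index-of x = ⟪ pred (left x) , right x ⟫

  index-ofᶜ : ∀ {S} → Comp S index-of
  index-ofᶜ = ⟪ predᶜ left′ , right′ ⟫ᶜ

  left-spine : ∀ n → left (spine n) ≡ 0
  left-spine n = left-⟪⟫ 0 n

  right-spine : ∀ n → right (spine n) ≡ n
  right-spine n = right-⟪⟫ 0 n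

  left-point : ∀ n → left (point n) ≡ suc (left n)
  left-point n = left-⟪⟫ (suc (left n)) (right n)

  index-point : ∀ n → index-of (point n) ≡ n
  index-point n = trans (cong₂ (λ x y → ⟪ pred x , y ⟫) (left-point n) (right-⟪⟫ (suc (left n)) (right n)))
    (⟪left,right⟫ n)

  spine-or-point : ∀ x → (∃[ m ] x ≡ spine m) ⊎ (∃[ n ] x ≡ point n)
  spine-or-point x with left x in eq
  ... | zero  = inj₁ (right x , trans (sym (⟪left,right⟫ x)) (cong (λ k → ⟪ k , right x ⟫) eq))
  ... | suc k = inj₂ (⟪ k , right x ⟫ , trans (sym (⟪left,right⟫ x))
    (cong₂ ⟪_,_⟫ (trans eq (cong suc (sym (left-⟪⟫ k (right x))))) (sym (right-⟪⟫ k (right x)))))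

-- The digraph M has edges from spine n to spine 0 and spine (suc n), and from
-- point n to spine (suc n) and spine (suc (a n)).
module Graph (a : ℕ → ℕ) where

  private
    -- These are the places of the spine to which x has edges. The successors in the values at
    -- points keep points off spine 0, to which every spine element has an edge; this tells the two
    -- kinds apart.
    target₀ target₁ : ℕ → ℕ
    target₀ x = ifz (left x) 0 (suc (index-of x))
    target₁ x = ifz (left x) (suc (right x)) (suc (a (index-of x)))

  E-test : ℕ → ℕ → ℕ
  E-test x y = ifz (left y) (ifz (dist (right y) (target₀ x)) 0 (dist (right y) (target₁ x))) 1

  E-testᶜ : ∀ {S f g} → Comp S a → Comp S f → Comp S g → Comp S (λ n → E-test (f n) (g n))
  E-testᶜ {S} A F G =
    ifzᶜ (lᶜ G) (ifzᶜ (distᶜ (rᶜ G) (T₀ ∘ᶜ F)) (const′ 0) (distᶜ (rᶜ G) (T₁ ∘ᶜ F))) (const′ 1)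
    where
    T₀ : Comp S target₀
    T₀ = ifzᶜ left′ (const′ 0) (sucᶜ index-ofᶜ)
    T₁ : Comp S target₁
    T₁ = ifzᶜ left′ (sucᶜ right′) (sucᶜ (A ∘ᶜ index-ofᶜ))

  opaque
    E : ℕ → ℕ → Set
    E x y = E-test x y ≡ 0

    E⇒test : ∀ {x y} → E x y → E-test x y ≡ 0
    E⇒test e = e

    test⇒E : ∀ {x y} → E-test x y ≡ 0 → E x y
    test⇒E e = e

    private
      E⁻ : ∀ x y → E x y → left y ≡ 0 × (right y ≡ target₀ x ⊎ right y ≡ target₁ x)
      E⁻ x y e with left y
      ... | zero with dist (right y) (target₀ x) in eq
      ...   | zero  = refl , inj₁ (dist≡0 eq)
      ...   | suc _ = refl , inj₂ (dist≡0 e)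

      E⁺ : ∀ x y → left y ≡ 0 → right y ≡ target₀ x ⊎ right y ≡ target₁ x → E x y
      E⁺ x y l r with left y
      E⁺ x y refl (inj₁ r) | .0 = ifz-zero (trans (cong (λ k → dist k (target₀ x)) r) (dist-refl (target₀ x)))
      E⁺ x y refl (inj₂ r) | .0 with dist (right y) (target₀ x)
      ... | zero  = refl
      ... | suc _ = trans (cong (λ k → dist k (target₁ x)) r) (dist-refl (target₁ x))

      target₀-spine : ∀ n → target₀ (spine n) ≡ 0
      target₀-spine n = ifz-zero (left-spine n)
      target₁-spine : ∀ n → target₁ (spine n) ≡ suc n
      target₁-spine n = trans (ifz-zero (left-spine n)) (cong suc (right-spine n))
      target₀-point : ∀ n → target₀ (point n) ≡ suc n
      target₀-point n = trans (ifz-nonzero (λ z → 1+n≢0 (trans (sym (left-point n)) z))) (cong suc (index-point n))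
      target₁-point : ∀ n → target₁ (point n) ≡ suc (a n)
      target₁-point n = trans (ifz-nonzero (λ z → 1+n≢0 (trans (sym (left-point n)) z))) (cong (suc ∘ a) (index-point n))

    ¬E-point : ∀ {x n} → ¬ E x (point n)
    ¬E-point {x} {n} e with () ← trans (sym (left-point n)) (proj₁ (E⁻ x (point n) e))

    spine-E⁻ : ∀ {n m} → E (spine n) (spine m) → m ≡ 0 ⊎ m ≡ suc n
    spine-E⁻ {n} {m} e = Sum.map
      (λ p → trans (sym (right-spine m)) (trans p (target₀-spine n)))
      (λ p → trans (sym (right-spine m)) (trans p (target₁-spine n)))
      (proj₂ (E⁻ (spine n) (spine m) e))

    point-E⁻ : ∀ {n m} → E (point n) (spine m) → m ≡ suc n ⊎ m ≡ suc (a n)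
    point-E⁻ {n} {m} e = Sum.map
      (λ p → trans (sym (right-spine m)) (trans p (target₀-point n)))
      (λ p → trans (sym (right-spine m)) (trans p (target₁-point n)))
      (proj₂ (E⁻ (point n) (spine m) e))

    spine-E-0 : ∀ n → E (spine n) (spine 0)
    spine-E-0 n = E⁺ (spine n) (spine 0) (left-spine 0)
      (inj₁ (trans (right-spine 0) (sym (target₀-spine n))))

    spine-E-suc : ∀ n → E (spine n) (spine (suc n))
    spine-E-suc n = E⁺ (spine n) (spine (suc n)) (left-spine (suc n))
      (inj₂ (trans (right-spine (suc n)) (sym (target₁-spine n))))

    point-E-self : ∀ n → E (point n) (spine (suc n))
    point-E-self n = E⁺ (point n) (spine (suc n)) (left-spine (suc n))
      (inj₁ (trans (right-spine (suc n)) (sym (target₀-point n))))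

    point-E-att : ∀ {n m} → m ≡ a n → E (point n) (spine (suc m))
    point-E-att {n} refl = E⁺ (point n) (spine (suc (a n))) (left-spine (suc (a n)))
      (inj₂ (trans (right-spine (suc (a n))) (sym (target₁-point n))))

  -- The structure M and its rigidity

  M : Structure digraph
  M = record { dom = λ _ → ⊤ ; rel = λ { _ (x ∷ y ∷ []) → E x y } ; fun = λ _ _ → 0 ; closed = λ () }

  -- One notion for two kinds of partial map: embeddings, indexed by the members of a list, and
  -- tuples related by `≃`, indexed by positions.
  record PartialIso {I : Set} (ρ ρ′ : I → ℕ) : Set where
    field
      preserves : ∀ i j → E (ρ i) (ρ j) → E (ρ′ i) (ρ′ j)
      reflects  : ∀ i j → E (ρ′ i) (ρ′ j) → E (ρ i) (ρ j)
      separates : ∀ i j → ρ′ i ≡ ρ′ j → ρ i ≡ ρ j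

  module Rigid {I : Set} {ρ ρ′ : I → ℕ} (iso : PartialIso ρ ρ′)
               (N : ℕ) (covers : ∀ m → m ≤ N → ∃[ i ] ρ i ≡ spine m) where
    open PartialIso iso

    -- Spine 0 is the only element with a loop. Beyond it, spine `suc m` is the only target of spine
    -- m other than spine 0, and spine 0 is ruled out by injectivity.
    spine-fixed : ∀ m → m ≤ N → ∀ i → ρ i ≡ spine m → ρ′ i ≡ spine m
    spine-fixed zero m≤N i eq with spine-or-point (ρ′ i)
      | preserves i i (subst₂ E (sym eq) (sym eq) (spine-E-0 0))
    ... | inj₂ (n , p) | e = ⊥-elim (¬E-point (subst (E (ρ′ i)) p e))
    ... | inj₁ (m , p) | e with spine-E⁻ (subst₂ E p p e)
    ...   | inj₁ refl = p
    ...   | inj₂ ()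
    spine-fixed (suc m) m≤N i eq
      with covers m (<⇒≤ m≤N) | covers 0 z≤n
    ... | j , eqⱼ | o , eqₒ
      with spine-fixed m (<⇒≤ m≤N) j eqⱼ | spine-fixed 0 z≤n o eqₒ
         | preserves j i (subst₂ E (sym eqⱼ) (sym eq) (spine-E-suc m)) | spine-or-point (ρ′ i)
    ... | fⱼ | fₒ | e | inj₂ (n , p) = ⊥-elim (¬E-point (subst (E (ρ′ j)) p e))
    ... | fⱼ | fₒ | e | inj₁ (n , p) with spine-E⁻ (subst₂ E fⱼ p e)
    ...   | inj₂ refl = p
    ...   | inj₁ refl with () ← spine-injective (trans (sym eqₒ) (trans (separates o i (trans fₒ (sym p))) eq))

    -- A spine element as image would have an edge to spine 0, which is fixed, and this edge would
    -- be reflected to point n, which has none.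
    point-image : ∀ i {n} → ρ i ≡ point n → ∃[ q ] ρ′ i ≡ point q
    point-image i {n} eq with spine-or-point (ρ′ i)
    ... | inj₂ p       = p
    ... | inj₁ (m , p) with covers 0 z≤n
    ...   | o , eqₒ with point-E⁻ (subst₂ E eq eqₒ (reflects i o
                     (subst₂ E (sym p) (sym (spine-fixed 0 z≤n o eqₒ)) (spine-E-0 m))))
    ...     | inj₁ ()
    ...     | inj₂ ()

    edge-to-spine⁺ : ∀ i m → m ≤ N → E (ρ i) (spine m) → E (ρ′ i) (spine m)
    edge-to-spine⁺ i m m≤N e with covers m m≤N
    ... | j , eq = subst (E (ρ′ i)) (spine-fixed m m≤N j eq) (preserves i j (subst (E (ρ i)) (sym eq) e))

    edge-to-spine⁻ : ∀ i m → m ≤ N → E (ρ′ i) (spine m) → E (ρ i) (spine m)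
    edge-to-spine⁻ i m m≤N e with covers m m≤N
    ... | j , eq = subst (E (ρ i)) eq (reflects i j (subst (E (ρ′ i)) (sym (spine-fixed m m≤N j eq)) e))

  below : ℕ → List ℕ
  below n = applyDownFrom spine (suc n)

  spine-∈-below : ∀ {m n} → m ≤ n → spine m ∈ˡ below n
  spine-∈-below m≤n = ∈-applyDownFrom⁺ spine (s≤s m≤n)

  inclusion : ∀ {l l′} → (∀ {x} → x ∈ˡ l → x ∈ˡ l′) → cl M l ↪ cl M l′
  inclusion l⊆l′ = digraph-embedding id (gen ∘ l⊆l′ ∘ Gen⁻) (λ _ _ → id) (λ _ _ → mk⇔ id id)

  inclusion-M : ∀ {l} → cl M l ↪ M
  inclusion-M = digraph-embedding id (λ _ → tt) (λ _ _ → id) (λ _ _ → mk⇔ id id)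

  all-M : ∀ l → All (dom M) l
  all-M l = ListAll.universal (λ _ → tt) l

  cl-member : ∀ l → cl M l ∈ members (ageOf M)
  cl-member l = l , all-M l , ≅-refl

  embedding-iso : ∀ {l} (f : cl M l ↪ M) →
                  PartialIso {I = ∃ (_∈ˡ l)} proj₁ (map-of f ∘ proj₁)
  embedding-iso f = record
    { preserves = λ (_ , x∈) (_ , y∈) → to (edge-⇔ f (gen x∈) (gen y∈))
    ; reflects  = λ (_ , x∈) (_ , y∈) → from (edge-⇔ f (gen x∈) (gen y∈))
    ; separates = λ (_ , x∈) (_ , y∈) → injective f (gen x∈) (gen y∈)
    }

  ≃-iso : ∀ {l l′ k c} → (cl M l , k ≃ cl M l′ , c) →
          Σ[ ρ ∈ (Fin (length k) → ℕ) ] (∀ i → ρ i ∈ˡ c) × PartialIso (lookup k) ρ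
  ≃-iso {k = k} {c} e = lookup c ∘ cast same-length , (λ i → ∈-lookup {xs = c} (cast same-length i)) , record
    { preserves = λ i j → to (same-atomic (atom refl (var i ∷ var j ∷ [])))
    ; reflects  = λ i j → from (same-atomic (atom refl (var i ∷ var j ∷ [])))
    ; separates = λ i j → from (same-atomic (var i ≈ var j))
    }
    where open _,_≃_,_ e

  -- Amalgamation bases in the age of M

  module _ (em : ExcludedMiddle 0ℓ) where

    member-↪-M : ∀ {B} → B ∈ members (ageOf M) → B ↪ M
    member-↪-M (_ , _ , f , onto) = ↪-trans (≅-inverse em f onto) inclusion-M

    -- Once B and C are replaced by finite parts b and c of M, rigidity turns both embeddings into
    -- the identity on l, so the inclusions into `b ++ c` commute with them.
    rigid⇒base : ∀ {l} → (∀ (f : cl M l ↪ M) {x} → x ∈ˡ l → map-of f x ≡ x) →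
                 AmalgamationBase (ageOf M) (cl M l)
    rigid⇒base {l} rigid = cl-member l , λ { (b , _ , i , i-onto) (c , _ , j , j-onto) f g →
      cl M (b ++ c) , cl-member (b ++ c) ,
      ↪-trans (≅-inverse em i i-onto) (inclusion ∈-++⁺ˡ) ,
      ↪-trans (≅-inverse em j j-onto) (inclusion (∈-++⁺ʳ b)) ,
      λ x∈ → trans (rigid (↪-trans f (↪-trans (≅-inverse em i i-onto) inclusion-M)) (Gen⁻ x∈))
              (sym (rigid (↪-trans g (↪-trans (≅-inverse em j j-onto) inclusion-M)) (Gen⁻ x∈))) }

    module _ (a≤ : ∀ n → a n ≤ n) (finite-to-one : ∀ N → ∃[ B ] ∀ n → a n ≤ N → n ≤ B) where

      hull : ℕ → ℕ → List ℕ
      hull B N = below (suc B) ++ applyDownFrom point (suc N)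

      -- An embedding of a hull fixes the spine, hence sends point n to some
      -- point q with n = q or n = a q.  The bound B puts the spine element
      -- suc q into the hull, so that q can be recovered from the edges.
      hull-rigid : ∀ N B → N ≤ B → (∀ n → a n ≤ N → n ≤ B) →
                   (f : cl M (hull B N) ↪ M) → ∀ {x} → x ∈ˡ hull B N → map-of f x ≡ x
      hull-rigid N B N≤B bound f {x} x∈ with ∈-++⁻ (below (suc B)) x∈
      ... | inj₁ x∈s with ∈-applyDownFrom⁻ spine x∈s
      ...   | m , s≤s m≤ , refl = spine-fixed m m≤ (x , x∈) refl
        where open Rigid (embedding-iso f) (suc B) (λ m m≤ → (spine m , ∈-++⁺ˡ (spine-∈-below m≤)) , refl)
      hull-rigid N B N≤B bound f {x} x∈ | inj₂ x∈p with ∈-applyDownFrom⁻ point x∈p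
      ... | n , s≤s n≤N , refl = fixes (point-image (x , x∈) refl)
        where
        open Rigid (embedding-iso f) (suc B) (λ m m≤ → (spine m , ∈-++⁺ˡ (spine-∈-below m≤)) , refl)
        fixes : ∃[ q ] map-of f x ≡ point q → map-of f x ≡ x
        fixes (q , p) with point-E⁻ (subst (λ y → E y (spine (suc n))) p
                             (edge-to-spine⁺ (x , x∈) (suc n) (s≤s (≤-trans n≤N N≤B)) (point-E-self n)))
        ... | inj₁ refl = p
        ... | inj₂ n≡aq = trans p (cong point q≡n)
          where
          aq≤N : a q ≤ N
          aq≤N = subst (_≤ N) (suc-injective n≡aq) n≤N
          q≤n : q ≤ n
          q≤n with point-E⁻ (edge-to-spine⁻ (x , x∈) (suc q) (s≤s (bound q aq≤N))
                     (subst (λ y → E y (spine (suc q))) (sym p) (point-E-self q)))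
          ... | inj₁ eq = ≤-reflexive (suc-injective eq)
          ... | inj₂ eq = subst (_≤ n) (sym (suc-injective eq)) (a≤ n)
          q≡n : q ≡ n
          q≡n = ≤-antisym q≤n (subst (_≤ q) (sym (suc-injective n≡aq)) (a≤ q))

      -- A spine element or point is at least as large as its index, so a bound N for the members of
      -- l puts l inside the hull for N.
      cap : CAP (ageOf M)
      cap {A} (l , _ , f , onto) with l-bound l
        where
        l-bound : ∀ l → ∃[ N ] All (_≤ N) l
        l-bound []      = 0 , ListAll.[]
        l-bound (x ∷ l) with l-bound l
        ... | N , p = x ⊔ N , (m≤m⊔n x N) ListAll.∷ ListAll.map (λ y≤N → ≤-trans y≤N (m≤n⊔m x N)) p
      ... | N , l≤N with finite-to-one N
      ... | B , bound = cl M (hull B N) , rigid⇒base (hull-rigid N B N≤B bound) ,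
                        ↪-trans (≅-inverse em f onto) (inclusion l⊆hull)
        where
        N≤B : N ≤ B
        -- N itself is one of the numbers that `a` sends to at most N.
        N≤B = bound N (a≤ N)
        l⊆hull : ∀ {x} → x ∈ˡ l → x ∈ˡ hull B N
        l⊆hull {x} x∈l with spine-or-point x | ListAll.lookup l≤N x∈l
        ... | inj₁ (m , refl) | x≤N = ∈-++⁺ˡ (spine-∈-below
                (m≤n⇒m≤1+n (≤-trans (n≤spine m) (≤-trans x≤N N≤B))))
        ... | inj₂ (n , refl) | x≤N = ∈-++⁺ʳ (below (suc B))
                (∈-applyDownFrom⁺ point (s≤s (≤-trans (n≤point n) x≤N)))

    module Exchange {l k n} (ak≡k : a k ≡ k) (an≡k : a n ≡ k)
                    (n∉l : point n ∉ˡ l) (s∉l : spine (suc n) ∉ˡ l) where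

      swap : ℕ → ℕ
      swap x with x ≟ point k
      ... | yes _ = point n
      ... | no  _ = x

      -- Both extensions get the spine up to `suc n`, so that embeddings of either into M fix the
      -- place that distinguishes point n from point k.
      l₀ l₁ : List ℕ
      l₀ = l ++ below (suc n)
      l₁ = map swap l ++ below (suc n)

      swap-injective : ∀ {x y} → x ∈ˡ l → y ∈ˡ l → swap x ≡ swap y → x ≡ y
      swap-injective {x} {y} x∈ y∈ eq with x ≟ point k | y ≟ point k
      ... | yes p | yes q = trans p (sym q)
      ... | no _  | no _  = eq
      ... | yes _ | no _  = ⊥-elim (n∉l (subst (_∈ˡ l) (sym eq) y∈))
      ... | no _  | yes _ = ⊥-elim (n∉l (subst (_∈ˡ l) eq x∈))

      swap-k : swap (point k) ≡ point n
      swap-k with point k ≟ point k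
      ... | yes _  = refl
      ... | no k≢k = ⊥-elim (k≢k refl)

      swap-spine : ∀ m → swap (spine m) ≡ spine m
      swap-spine m with spine m ≟ point k
      ... | yes p = ⊥-elim (spine≢point p)
      ... | no _  = refl

      -- Points k and n share the target spine `suc k`. The only target not shared is spine `suc n`,
      -- and that is missing from l.
      swap-edge-spine : ∀ x m → spine m ∈ˡ l → E x (spine m) ⇔ E (swap x) (spine m)
      swap-edge-spine x m m∈ with x ≟ point k
      ... | no _     = mk⇔ id id
      ... | yes refl = mk⇔ ⇒ ⇐
        where
        ⇒ : E (point k) (spine m) → E (point n) (spine m)
        ⇒ e with point-E⁻ e
        ... | inj₁ refl = point-E-att (sym an≡k)
        ... | inj₂ refl = point-E-att (trans ak≡k (sym an≡k))
        ⇐ : E (point n) (spine m) → E (point k) (spine m)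
        ⇐ e with point-E⁻ e
        ... | inj₁ refl = ⊥-elim (s∉l m∈)
        ... | inj₂ refl = point-E-att (trans an≡k (sym ak≡k))

      swap-edge : ∀ {x y} → x ∈ˡ l → y ∈ˡ l → E x y ⇔ E (swap x) (swap y)
      swap-edge {x} {y} x∈ y∈ with spine-or-point y
      ... | inj₁ (m , refl) = subst (λ y → E x (spine m) ⇔ E (swap x) y) (sym (swap-spine m))
                                (swap-edge-spine x m y∈)
      ... | inj₂ (m , refl) = mk⇔ (⊥-elim ∘ ¬E-point) (λ e → ⊥-elim (swapped e))
        where
        swapped : ¬ E (swap x) (swap (point m))
        swapped e with point m ≟ point k
        ... | yes _ = ¬E-point e
        ... | no  _ = ¬E-point e

      exchange : cl M l ↪ cl M l₁
      exchange = digraph-embedding swap (gen ∘ ∈-++⁺ˡ ∘ ∈-map⁺ swap ∘ Gen⁻)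
        (λ x∈ y∈ → swap-injective (Gen⁻ x∈) (Gen⁻ y∈))
        (λ x∈ y∈ → swap-edge (Gen⁻ x∈) (Gen⁻ y∈))

    -- Exchanging point k for point n embeds l into M a second time; the two
    -- embeddings are told apart by the edge from point n to spine (suc n).
    not-base : ∀ {l k n} → a k ≡ k → a n ≡ k → n ≢ k →
               point k ∈ˡ l → point n ∉ˡ l → spine (suc n) ∉ˡ l →
               ¬ AmalgamationBase (ageOf M) (cl M l)
    not-base {l} {k} {n} ak≡k an≡k n≢k k∈l n∉l s∉l (_ , amalgamate) =
      absurd (amalgamate (cl-member l₀) (cl-member l₁) (inclusion ∈-++⁺ˡ) exchange)
      where
      open Exchange ak≡k an≡k n∉l s∉l

      absurd : ¬ (∃[ D ] D ∈ members (ageOf M) × Σ[ α ∈ cl M l₀ ↪ D ] Σ[ β ∈ cl M l₁ ↪ D ]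
                   (∀ {x} → x ∈ dom (cl M l) → map-of α x ≡ map-of β (swap x)))
      absurd (D , D∈ , α , β , commutes) = edge-k-n (R₀.edge-to-spine⁻ (point k , ∈-++⁺ˡ k∈l) (suc n) ≤-refl
        (subst (λ z → E z (spine (suc n))) (sym images-agree)
          (R₁.edge-to-spine⁺ (swap (point k) , ∈-++⁺ˡ (∈-map⁺ swap k∈l)) (suc n) ≤-refl
            (subst (λ z → E z (spine (suc n))) (sym swap-k) (point-E-self n)))))
        where
        module R₀ = Rigid (embedding-iso (↪-trans α (member-↪-M D∈))) (suc n)
          (λ m m≤ → (spine m , ∈-++⁺ʳ l (spine-∈-below m≤)) , refl)
        module R₁ = Rigid (embedding-iso (↪-trans β (member-↪-M D∈))) (suc n)
          (λ m m≤ → (spine m , ∈-++⁺ʳ (map swap l) (spine-∈-below m≤)) , refl)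
        images-agree : map-of (↪-trans α (member-↪-M D∈)) (point k) ≡
                       map-of (↪-trans β (member-↪-M D∈)) (swap (point k))
        images-agree = cong (map-of (member-↪-M D∈)) (commutes (gen k∈l))
        edge-k-n : ¬ E (point k) (spine (suc n))
        edge-k-n e with point-E⁻ e
        ... | inj₁ eq = n≢k (suc-injective eq)
        ... | inj₂ eq = n≢k (trans (suc-injective eq) ak≡k)

  anchor : ℕ → List ℕ
  anchor k = point k ∷ below (suc k)

  -- The spine up to `suc k` is fixed, so point k goes to a point with an edge to spine `suc k`.
  -- With `att` for a and k = `⟪ e , 0 ⟫` for a halting e, only two candidates remain.
  anchor-image : ∀ {l l′ k c} → (cl M l , anchor k ≃ cl M l′ , c) →
                 ∃[ q ] point q ∈ˡ c × (q ≡ k ⊎ a q ≡ k)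
  anchor-image {k = k} {c} e = q , subst (_∈ˡ c) eq (proj₁ (proj₂ (≃-iso e)) Fin.zero) ,
    Sum.map (sym ∘ suc-injective) (sym ∘ suc-injective) (point-E⁻
      (subst (λ z → E z (spine (suc k))) eq (edge-to-spine⁺ Fin.zero (suc k) ≤-refl (point-E-self k))))
    where
    spine-∈ : ∀ m → m ≤ suc k → spine m ∈ˡ anchor k
    spine-∈ m m≤ = there (spine-∈-below m≤)
    open Rigid (proj₂ (proj₂ (≃-iso e))) (suc k)
      (λ m m≤ → position-of (spine-∈ m m≤) , sym (lookup-index (spine-∈ m m≤)))
    q = proj₁ (point-image Fin.zero refl)
    eq = proj₂ (point-image Fin.zero refl)

-- Indices

private
  -- The first argument is fuel, and `depth c` of it suffices for the number of c. Only a left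
  -- inverse of `gödel` is wanted, so the values at other numbers are arbitrary.
  decode : ℕ → ℕ → Code
  decodeOp : ℕ → ℕ → ℕ → Code

  decode zero    _ = zeroᶜ
  decode (suc f) e = decodeOp f (left e) (right e)

  decodeOp f 0 _ = zeroᶜ
  decodeOp f 1 _ = succᶜ
  decodeOp f 2 _ = leftᶜ
  decodeOp f 3 _ = rightᶜ
  decodeOp f 4 _ = oracleᶜ
  decodeOp f 5 x = pairᶜ (decode f (left x)) (decode f (right x))
  decodeOp f 6 x = compᶜ (decode f (left x)) (decode f (right x))
  decodeOp f 7 x = precᶜ (decode f (left x)) (decode f (right x))
  decodeOp f _ x = muᶜ (decode f x)

  depth : Code → ℕ
  depth (pairᶜ c d) = suc (depth c ⊔ depth d)
  depth (compᶜ c d) = suc (depth c ⊔ depth d)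
  depth (precᶜ c d) = suc (depth c ⊔ depth d)
  depth (muᶜ c)     = suc (depth c)
  depth _           = 1

  decode-⟪⟫ : ∀ f op x → decode (suc f) ⟪ op , x ⟫ ≡ decodeOp f op x
  decode-⟪⟫ f op x = cong₂ (decodeOp f) (left-⟪⟫ op x) (right-⟪⟫ op x)

  decode-gödel : ∀ f c → depth c ≤ f → decode f (gödel c) ≡ c

  decode-both : ∀ f c d (con : Code → Code → Code) → depth c ⊔ depth d ≤ f →
    con (decode f (left ⟪ gödel c , gödel d ⟫)) (decode f (right ⟪ gödel c , gödel d ⟫)) ≡ con c d
  decode-both f c d con p = cong₂ con
    (trans (cong (decode f) (left-⟪⟫ (gödel c) (gödel d))) (decode-gödel f c (m⊔n≤o⇒m≤o _ _ p)))
    (trans (cong (decode f) (right-⟪⟫ (gödel c) (gödel d))) (decode-gödel f d (m⊔n≤o⇒n≤o (depth c) _ p)))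

  decode-gödel (suc f) zeroᶜ       _ = decode-⟪⟫ f 0 0
  decode-gödel (suc f) succᶜ       _ = decode-⟪⟫ f 1 0
  decode-gödel (suc f) leftᶜ       _ = decode-⟪⟫ f 2 0
  decode-gödel (suc f) rightᶜ      _ = decode-⟪⟫ f 3 0
  decode-gödel (suc f) oracleᶜ     _ = decode-⟪⟫ f 4 0
  decode-gödel (suc f) (pairᶜ c d) (s≤s p) =
    trans (decode-⟪⟫ f 5 ⟪ gödel c , gödel d ⟫) (decode-both f c d pairᶜ p)
  decode-gödel (suc f) (compᶜ c d) (s≤s p) =
    trans (decode-⟪⟫ f 6 ⟪ gödel c , gödel d ⟫) (decode-both f c d compᶜ p)
  decode-gödel (suc f) (precᶜ c d) (s≤s p) =
    trans (decode-⟪⟫ f 7 ⟪ gödel c , gödel d ⟫) (decode-both f c d precᶜ p)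
  decode-gödel (suc f) (muᶜ c)     (s≤s p) =
    trans (decode-⟪⟫ f 8 (gödel c)) (cong muᶜ (decode-gödel f c p))

abstract
  -- `φ` supplies some program with the given number; injectivity identifies it with the program
  -- that was constructed.
  gödel-injective : ∀ {c d} → gödel c ≡ gödel d → c ≡ d
  gödel-injective {c} {d} eq = trans (sym (decode-gödel f c (m≤m⊔n (depth c) (depth d))))
    (trans (cong (decode f) eq) (decode-gödel f d (m≤n⊔m (depth c) (depth d))))
    where
    f : ℕ
    f = depth c ⊔ depth d

φ-gödel : ∀ {S c n} → ∃ (φ S (gödel c) n) → ∃ (Eval S c n)
φ-gödel {S} {n = n} (m , d , eq , e) = m , subst (λ c → Eval S c n m) (gödel-injective eq) e

-- The s-m-n construction.
opaque
  constant : ℕ → Code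
  constant zero    = zeroᶜ
  constant (suc a) = compᶜ succᶜ (constant a)

  specialize : Code → ℕ → Code
  specialize X a = compᶜ X (pairᶜ (constant a) (code (id′ {∅})))

  private
    input : ∀ a n → Eval ∅ (pairᶜ (constant a) (code (id′ {∅}))) n ⟪ a , n ⟫
    input a n = e-pair (constant-correct a) (correct id′ n)
      where
      constant-correct : ∀ a → Eval ∅ (constant a) n a
      constant-correct zero    = e-zero
      constant-correct (suc a) = e-comp (constant-correct a) e-succ

  specialize-complete : ∀ {X} a n {m} → Eval ∅ X ⟪ a , n ⟫ m → Eval ∅ (specialize X a) n m
  specialize-complete a n e = e-comp (input a n) e

  specialize-sound : ∀ {X} a n {m} → Eval ∅ (specialize X a) n m → Eval ∅ X ⟪ a , n ⟫ m
  specialize-sound {X} a n {m} (e-comp i e) =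
    subst (λ k → Eval ∅ X k m) (eval-deterministic i (input a n)) e

  constantᶜ : ∀ {f} → Comp ∅ f → Comp ∅ (λ n → gödel (constant (f n)))
  constantᶜ {f} F = ext (λ n → lemma (f n)) (iterᶜ G F (const′ ⟪ 0 , 0 ⟫))
    where
    G : Comp ∅ (λ x → ⟪ 6 , ⟪ ⟪ 1 , 0 ⟫ , x ⟫ ⟫)
    G = ⟪ const′ 6 , ⟪ const′ ⟪ 1 , 0 ⟫ , id′ ⟫ᶜ ⟫ᶜ
    lemma : ∀ a → iter (λ x → ⟪ 6 , ⟪ ⟪ 1 , 0 ⟫ , x ⟫ ⟫) a ⟪ 0 , 0 ⟫ ≡ gödel (constant a)
    lemma zero    = refl
    lemma (suc a) = cong (λ x → ⟪ 6 , ⟪ ⟪ 1 , 0 ⟫ , x ⟫ ⟫) (lemma a)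

  specializeᶜ : ∀ X {f} → Comp ∅ f → Comp ∅ (λ n → gödel (specialize X (f n)))
  specializeᶜ X F = ⟪ const′ 6 , ⟪ const′ (gödel X) ,
    ⟪ const′ 5 , ⟪ constantᶜ F , const′ (gödel (code (id′ {∅}))) ⟫ᶜ ⟫ᶜ ⟫ᶜ ⟫ᶜ

record Comp₂ (f : ℕ → ℕ → ℕ) : Set where
  constructor comp₂
  field
    program : Comp ∅ (λ s → f (left s) (right s))

open Comp₂ public

apply₂ : ∀ (f : ℕ → ℕ → ℕ) a n → f (left ⟪ a , n ⟫) (right ⟪ a , n ⟫) ≡ f a n
apply₂ f a n = cong₂ f (left-⟪⟫ a n) (right-⟪⟫ a n)

module _ {f : ℕ → ℕ → ℕ} (F : Comp₂ f) where

  -- One binary test serves a whole family of sets. The index is computable in the parameter a,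
  -- which makes the sequence of indices in `𝕂` computable.
  enumerator decider : ℕ → ℕ
  enumerator a = gödel (specialize (semidecide (program F)) a)
  decider a = gödel (specialize (code (ifzᶜ (program F) (const′ 1) (const′ 0))) a)

  enumeratorᶜ : ∀ {g} → Comp ∅ g → Comp ∅ (λ n → enumerator (g n))
  enumeratorᶜ = specializeᶜ (semidecide (program F))

  deciderᶜ : ∀ {g} → Comp ∅ g → Comp ∅ (λ n → decider (g n))
  deciderᶜ = specializeᶜ (code (ifzᶜ (program F) (const′ 1) (const′ 0)))

  enumerates : ∀ a {P : Pred ℕ 0ℓ} → (∀ n → n ∈ P ⇔ f a n ≡ 0) → EnumeratedBy ∅ (enumerator a) P
  enumerates a P⇔ n = mk⇔
    (λ n∈ → 0 , specialize (semidecide (program F)) a , refl ,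
      specialize-complete a n (semidecide-complete (program F) (trans (apply₂ f a n) (to (P⇔ n) n∈))))
    sound
    where
    sound : ∃ (φ ∅ (enumerator a) n) → _
    sound h = from (P⇔ n) (trans (sym (apply₂ f a n))
      (semidecide-sound (program F) (specialize-sound a n (proj₂ (φ-gödel h)))))

  decides : ∀ a {P : Pred ℕ 0ℓ} → (∀ n → n ∈ P ⇔ f a n ≡ 0) → DecidedBy ∅ (decider a) P
  decides a {P} P⇔ n = (λ n∈ → _ , refl , run-at 1 (ifz-zero (to (P⇔ n) n∈))) ,
                       (λ n∉ → _ , refl , run-at 0 (from not≡0 (n∉ ∘ from (P⇔ n))))
    where
    run-at : ∀ m → not (f a n) ≡ m →
             Eval ∅ (specialize (code (ifzᶜ (program F) (const′ 1) (const′ 0))) a) n m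
    run-at m eq = specialize-complete a n (subst (Eval ∅ (code (ifzᶜ (program F) (const′ 1) (const′ 0))) ⟪ a , n ⟫)
      (trans (cong not (apply₂ f a n)) eq)
      (correct (ifzᶜ (program F) (const′ 1) (const′ 0)) ⟪ a , n ⟫))

-- Coded lists and membership in them

bounded-exists : (ℕ → ℕ) → ℕ → ℕ
bounded-exists f zero    = 1
bounded-exists f (suc k) = ifz (f k) 0 (bounded-exists f k)

abstract
  bounded-existsᶜ : ∀ {S} {f : ℕ → ℕ → ℕ} {b} → Comp S (λ s → f (left s) (right s)) → Comp S b →
                    Comp S (λ n → bounded-exists (f n) (b n))
  bounded-existsᶜ {S} {f} {b} F B = ext (λ n → lemma n (b n)) (primrecᶜ (const′ 1) G id′ B)
    where
    g : ℕ → ℕ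
    g s = ifz (f (left s) (left (right s))) 0 (right (right s))
    G : Comp S g
    G = ifzᶜ (ext (λ n → apply₂ f (left n) (left (right n))) (F ∘ᶜ ⟪ left′ , lᶜ right′ ⟫ᶜ))
             (const′ 0) (rᶜ right′)
    lemma : ∀ n k → primrec (λ _ → 1) g n k ≡ bounded-exists (f n) k
    lemma n zero    = refl
    lemma n (suc k) = let r = primrec (λ _ → 1) g n k in
      trans (cong₂ (λ x y → ifz (f x (left y)) 0 (right y))
              (left-⟪⟫ n ⟪ k , r ⟫) (right-⟪⟫ n ⟪ k , r ⟫))
        (cong₂ (λ x y → ifz (f n x) 0 y) (left-⟪⟫ k r) (trans (right-⟪⟫ k r) (lemma n k)))

bounded-exists⁺ : ∀ f {j k} → j < k → f j ≡ 0 → bounded-exists f k ≡ 0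
bounded-exists⁺ f {j} {suc k} j<1+k eq with f k in fk≡
... | zero  = refl
... | suc _ with m<1+n⇒m<n∨m≡n j<1+k
...   | inj₁ j<k  = bounded-exists⁺ f j<k eq
...   | inj₂ refl with () ← trans (sym fk≡) eq

bounded-exists⁻ : ∀ f k → bounded-exists f k ≡ 0 → ∃[ j ] f j ≡ 0
bounded-exists⁻ f (suc k) eq with f k in fk≡
... | zero  = k , fk≡
... | suc _ = bounded-exists⁻ f k eq

tail : ℕ → ℕ
tail n = right (pred n)

tail-∷ : ∀ x l → tail ⌜ x ∷ l ⌝ ≡ ⌜ l ⌝
tail-∷ x l = right-⟪⟫ x ⌜ l ⌝

head-∷ : ∀ x l → left (pred ⌜ x ∷ l ⌝) ≡ x
head-∷ x l = left-⟪⟫ x ⌜ l ⌝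

iter-tail-∷ : ∀ j x l → iter tail (suc j) ⌜ x ∷ l ⌝ ≡ iter tail j ⌜ l ⌝
iter-tail-∷ j x l = trans (sym (iter-comm tail j ⌜ x ∷ l ⌝)) (cong (iter tail j) (tail-∷ x l))

⌜⌝-∷-<ˡ : ∀ x l → x < ⌜ x ∷ l ⌝
⌜⌝-∷-<ˡ x l = s≤s (m≤⟪m,n⟫ x ⌜ l ⌝)

⌜⌝-∷-<ʳ : ∀ x l → ⌜ l ⌝ < ⌜ x ∷ l ⌝
⌜⌝-∷-<ʳ x l = s≤s (n≤⟪m,n⟫ x ⌜ l ⌝)

∈⇒<⌜⌝ : ∀ {x l} → x ∈ˡ l → x < ⌜ l ⌝
∈⇒<⌜⌝ {l = x ∷ l} (here refl) = ⌜⌝-∷-<ˡ x l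
∈⇒<⌜⌝ {l = y ∷ l} (there x∈)  = <-trans (∈⇒<⌜⌝ x∈) (⌜⌝-∷-<ʳ y l)

head-test : ℕ → ℕ → ℕ
head-test x n = ifz n 1 (dist (left (pred n)) x)

-- Each tail of a nonempty list has a smaller code, so the code of the list bounds the positions to
-- be searched.
member-test : ℕ → ℕ → ℕ
member-test n x = bounded-exists (λ j → head-test x (iter tail j n)) n

member-testᶜ : Comp₂ member-test
member-testᶜ = comp₂ (bounded-existsᶜ {f = λ s j → head-test (right s) (iter tail j (left s))}
  (ifzᶜ N (const′ 1) (distᶜ (lᶜ (predᶜ N)) (rᶜ left′))) left′)
  where
  N : Comp ∅ (λ s → iter tail (right s) (left (left s)))
  N = iterᶜ (rᶜ (predᶜ id′)) right′ (lᶜ left′)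

member-test⁺ : ∀ {x l} → x ∈ˡ l → member-test ⌜ l ⌝ x ≡ 0
member-test⁺ {x} {l} x∈ with position x∈
  where
  position : ∀ {l} → x ∈ˡ l → ∃[ j ] j < ⌜ l ⌝ × head-test x (iter tail j ⌜ l ⌝) ≡ 0
  position {y ∷ l} (here refl) = 0 , s≤s z≤n , trans (cong (λ z → dist z x) (head-∷ y l)) (dist-refl x)
  position {y ∷ l} (there x∈)  with position x∈
  ... | j , j< , eq = suc j , ≤-<-trans j< (⌜⌝-∷-<ʳ y l) ,
                      trans (cong (head-test x) (iter-tail-∷ j y l)) eq
... | j , j< , eq = bounded-exists⁺ (λ j → head-test x (iter tail j ⌜ l ⌝)) j< eq

member-test⁻ : ∀ {x l} → member-test ⌜ l ⌝ x ≡ 0 → x ∈ˡ l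
member-test⁻ {x} {l} eq with bounded-exists⁻ (λ j → head-test x (iter tail j ⌜ l ⌝)) ⌜ l ⌝ eq
... | j , eqⱼ = found j l eqⱼ
  where
  -- `tail` fixes the code 0 of the empty list because `⟪ 0 , 0 ⟫` is 0, so iterations past the end
  -- find nothing.
  iter-tail-0 : ∀ j → iter tail j 0 ≡ 0
  iter-tail-0 zero    = refl
  iter-tail-0 (suc j) = trans (cong tail (iter-tail-0 j)) (right-⟪⟫ 0 0)
  found : ∀ j l → head-test x (iter tail j ⌜ l ⌝) ≡ 0 → x ∈ˡ l
  found j [] eq with () ← trans (cong (head-test x) (sym (iter-tail-0 j))) eq
  found zero    (y ∷ l) eq = here (sym (trans (sym (head-∷ y l)) (dist≡0 eq)))
  found (suc j) (y ∷ l) eq = there (found j l (trans (cong (head-test x) (sym (iter-tail-∷ j y l))) eq))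

-- Every number codes a list. The number itself is enough fuel for decoding, as `right m` is at most
-- m.
list : ℕ → List ℕ
list n = go n n
  module List-of where
  go : ℕ → ℕ → List ℕ
  go zero    _       = []
  go (suc f) zero    = []
  go (suc f) (suc n) = left n ∷ go f (right n)

⌜list⌝ : ∀ n → ⌜ list n ⌝ ≡ n
⌜list⌝ n = lemma n n ≤-refl
  where
  lemma : ∀ f m → m ≤ f → ⌜ List-of.go n f m ⌝ ≡ m
  lemma zero    zero    _         = refl
  lemma (suc f) zero    _         = refl
  lemma (suc f) (suc m) (s≤s m≤f) = cong suc (trans
    (cong (λ k → ⟪ left m , k ⟫) (lemma f (right m) (≤-trans right≤ m≤f))) (⟪left,right⟫ m))
    where
    right≤ : right m ≤ m
    right≤ = subst (right m ≤_) (⟪left,right⟫ m) (n≤⟪m,n⟫ (left m) (right m))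

⌜⌝-injective : ∀ l l′ → ⌜ l ⌝ ≡ ⌜ l′ ⌝ → l ≡ l′
⌜⌝-injective []      []       _  = refl
⌜⌝-injective []      (_ ∷ _)  ()
⌜⌝-injective (_ ∷ _) []       ()
⌜⌝-injective (x ∷ l) (y ∷ l′) eq with ⟪⟫-injective x ⌜ l ⌝ y ⌜ l′ ⌝ (suc-injective eq)
... | p , q = cong₂ _∷_ p (⌜⌝-injective l l′ q)

list-⌜⌝ : ∀ l → list ⌜ l ⌝ ≡ l
list-⌜⌝ l = ⌜⌝-injective (list ⌜ l ⌝) l (⌜list⌝ ⌜ l ⌝)

-- Tests for atomic diagrams

private
  atom-code : ℕ → ℕ → ℕ
  atom-code u v = ⟪ 0 , ⌜ u ∷ v ∷ [] ⌝ ⟫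

  fst snd : ℕ → ℕ
  fst z = left (pred (right z))
  snd z = left (pred (tail (right z)))

  fst-atom : ∀ u v → fst (atom-code u v) ≡ u
  fst-atom u v = trans (cong (λ k → left (pred k)) (right-⟪⟫ 0 ⌜ u ∷ v ∷ [] ⌝)) (head-∷ u (v ∷ []))

  snd-atom : ∀ u v → snd (atom-code u v) ≡ v
  snd-atom u v = trans (cong (λ k → left (pred (tail k))) (right-⟪⟫ 0 ⌜ u ∷ v ∷ [] ⌝))
    (trans (cong (λ k → left (pred k)) (tail-∷ u (v ∷ []))) (head-∷ v []))

  fstᶜ : ∀ {f} → Comp ∅ f → Comp ∅ (λ n → fst (f n))
  fstᶜ F = lᶜ (predᶜ (rᶜ F))

  sndᶜ : ∀ {f} → Comp ∅ f → Comp ∅ (λ n → snd (f n))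
  sndᶜ F = lᶜ (predᶜ (rᶜ (predᶜ (rᶜ F))))

  -- With 0 for truth, a sum is a conjunction. The first summand makes sure that z codes an atom at
  -- all, before its two arguments are tested for membership and for r.
  atom-test : (ℕ → ℕ → ℕ) → (ℕ → ℕ → ℕ) → ℕ → ℕ → ℕ
  atom-test δ r p z = dist z (atom-code (fst z) (snd z)) + (δ p (fst z) + (δ p (snd z) + r (fst z) (snd z)))

  atom-testᶜ : ∀ {δ r} → Comp₂ δ → Comp₂ r → Comp₂ (atom-test δ r)
  atom-testᶜ {δ} {r} D R = comp₂
    (distᶜ right′ ⟪ const′ 0 , sucᶜ ⟪ F , sucᶜ ⟪ G , const′ 0 ⟫ᶜ ⟫ᶜ ⟫ᶜ
      +ᶜ (binary D left′ F +ᶜ (binary D left′ G +ᶜ binary R F G)))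
    where
    F : Comp ∅ (λ s → fst (right s))
    F = fstᶜ right′
    G : Comp ∅ (λ s → snd (right s))
    G = sndᶜ right′
    binary : ∀ {f g h} → Comp₂ f → Comp ∅ g → Comp ∅ h → Comp ∅ (λ n → f (g n) (h n))
    binary {f} {g} {h} C G H = ext (λ n → apply₂ f (g n) (h n)) (program C ∘ᶜ ⟪ G , H ⟫ᶜ)

  atom-test-⇔ : ∀ δ r p z → atom-test δ r p z ≡ 0 ⇔
                (∃[ u ] ∃[ v ] z ≡ atom-code u v × δ p u ≡ 0 × δ p v ≡ 0 × r u v ≡ 0)
  atom-test-⇔ δ r p z = mk⇔ ⇒ ⇐
    where
    ⇒ : _
    ⇒ eq = fst z , snd z , dist≡0 (m+n≡0⇒m≡0 _ eq) , m+n≡0⇒m≡0 _ eq₁ , m+n≡0⇒m≡0 _ eq₂ , m+n≡0⇒n≡0 _ eq₂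
      where
      eq₁ = m+n≡0⇒n≡0 (dist z (atom-code (fst z) (snd z))) eq
      eq₂ = m+n≡0⇒n≡0 (δ p (fst z)) eq₁
    ⇐ : _
    ⇐ (u , v , refl , p₁ , p₂ , p₃) = cong₂ _+_
      (trans (cong₂ (λ x y → dist z (atom-code x y)) (fst-atom u v) (snd-atom u v)) (dist-refl z))
      (cong₂ _+_ (trans (cong (δ p) (fst-atom u v)) p₁)
        (cong₂ _+_ (trans (cong (δ p) (snd-atom u v)) p₂)
          (trans (cong₂ r (fst-atom u v) (snd-atom u v)) p₃)))

-- The canonical computable age of M

module Indexing (a : ℕ → ℕ) (aᶜ : Comp ∅ a) where
  open Graph a

  private
    non-E-test : ℕ → ℕ → ℕ
    non-E-test u v = not (E-test u v)

    positive-test negative-test : (ℕ → ℕ → ℕ) → ℕ → ℕ → ℕ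
    positive-test δ = atom-test δ E-test
    negative-test δ = atom-test δ non-E-test

    Eᶜ : Comp₂ E-test
    Eᶜ = comp₂ (E-testᶜ aᶜ left′ right′)

  module _ {δ : ℕ → ℕ → ℕ} (δᶜ : Comp₂ δ) where

    private
      positiveᶜ : Comp₂ (positive-test δ)
      positiveᶜ = atom-testᶜ δᶜ Eᶜ

      negativeᶜ : Comp₂ (negative-test δ)
      negativeᶜ = atom-testᶜ {r = non-E-test} δᶜ (comp₂ (ifzᶜ (program Eᶜ) (const′ 1) (const′ 0)))

      nothingᶜ : Comp₂ (λ _ _ → 1)
      nothingᶜ = comp₂ (const′ 1)

    structure-index : ℕ → ℕ
    structure-index p = ⟪ decider δᶜ p , ⟪ enumerator positiveᶜ p ,
                        ⟪ enumerator negativeᶜ p , enumerator nothingᶜ p ⟫ ⟫ ⟫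

    structure-indexᶜ : ∀ {f} → Comp ∅ f → Comp ∅ (λ n → structure-index (f n))
    structure-indexᶜ F = ⟪ deciderᶜ δᶜ F , ⟪ enumeratorᶜ positiveᶜ F ,
                         ⟪ enumeratorᶜ negativeᶜ F , enumeratorᶜ nothingᶜ F ⟫ᶜ ⟫ᶜ ⟫ᶜ

    is-index : ∀ p (D : Pred ℕ 0ℓ) → (∀ x → x ∈ D ⇔ δ p x ≡ 0) →
               IsIndex {digraph} (structure-index p) (record { dom = D ; rel = rel M ; fun = fun M ; closed = λ () })
    is-index p D D⇔ =
      decider δᶜ p , enumerator positiveᶜ p , enumerator negativeᶜ p , enumerator nothingᶜ p , refl ,
      decides δᶜ p D⇔ , enumerates positiveᶜ p positive , enumerates negativeᶜ p negative ,
      enumerates nothingᶜ p λ _ → mk⇔ (λ { (_ , _ , () , _) }) (λ ())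
      where
      positive : ∀ z → (∃[ n ] Σ[ v ∈ Vec ℕ 2 ] n ≡ 0 × Allᵛ D v × rel M n v × z ≡ ⟪ n , ⌜ toList v ⌝ ⟫)
                       ⇔ positive-test δ p z ≡ 0
      positive z = mk⇔
        (λ { (_ , u ∷ v ∷ [] , refl , (u∈ ∷ v∈ ∷ []) , e , eq) →
             from (atom-test-⇔ δ E-test p z) (u , v , eq , to (D⇔ u) u∈ , to (D⇔ v) v∈ , E⇒test e) })
        (λ eq → let (u , v , eq′ , u∈ , v∈ , e) = to (atom-test-⇔ δ E-test p z) eq in
             0 , u ∷ v ∷ [] , refl , (from (D⇔ u) u∈ ∷ from (D⇔ v) v∈ ∷ []) , test⇒E e , eq′)
      negative : ∀ z → (∃[ n ] Σ[ v ∈ Vec ℕ 2 ] n ≡ 0 × Allᵛ D v × ¬ rel M n v × z ≡ ⟪ n , ⌜ toList v ⌝ ⟫)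
                       ⇔ negative-test δ p z ≡ 0
      negative z = mk⇔
        (λ { (_ , u ∷ v ∷ [] , refl , (u∈ ∷ v∈ ∷ []) , ¬e , eq) →
             from (atom-test-⇔ δ non-E-test p z) (u , v , eq , to (D⇔ u) u∈ , to (D⇔ v) v∈ , from not≡0 (¬e ∘ test⇒E)) })
        (λ eq → let (u , v , eq′ , u∈ , v∈ , e) = to (atom-test-⇔ δ non-E-test p z) eq in
             0 , u ∷ v ∷ [] , refl , (from (D⇔ u) u∈ ∷ from (D⇔ v) v∈ ∷ []) , (to not≡0 e ∘ E⇒test) , eq′)

  M-computable : ComputableStructure M
  M-computable = structure-index δᶜ 0 , is-index δᶜ 0 (dom M) λ _ → mk⇔ (λ _ → refl) (λ _ → tt)
    where
    δᶜ : Comp₂ (λ _ _ → 0)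
    δᶜ = comp₂ (const′ 0)

  -- The right half of i is padding, by which every tuple appears infinitely often.
  tuple-of : ℕ → List ℕ
  tuple-of i = list (left i)

  tuple-of-⟪⟫ : ∀ l n → tuple-of ⟪ ⌜ l ⌝ , n ⟫ ≡ l
  tuple-of-⟪⟫ l n = trans (cong list (left-⟪⟫ ⌜ l ⌝ n)) (list-⌜⌝ l)

  private
    triple : ℕ → ℕ
    triple i = ⟪ left i , ⟪ structure-index member-testᶜ (left i) , i ⟫ ⟫

    member-⇔ : ∀ i x → Gen M (tuple-of i) x ⇔ member-test (left i) x ≡ 0
    member-⇔ i x = mk⇔
      (λ x∈ → subst (λ k → member-test k x ≡ 0) (⌜list⌝ (left i)) (member-test⁺ (Gen⁻ x∈)))
      (λ eq → gen (member-test⁻ (subst (λ k → member-test k x ≡ 0) (sym (⌜list⌝ (left i))) eq)))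

    triple-≡ : ∀ i → ⟪ ⌜ tuple-of i ⌝ , ⟪ structure-index member-testᶜ (left i) , i ⟫ ⟫ ≡ triple i
    triple-≡ i = cong (λ k → ⟪ k , ⟪ structure-index member-testᶜ (left i) , i ⟫ ⟫) (⌜list⌝ (left i))

    -- A triple is determined by its last component i, from which the other two are recomputed and
    -- compared.
    triple-test : ℕ → ℕ
    triple-test x = dist x (triple (right (right x)))

    triple-testᶜ : Comp ∅ triple-test
    triple-testᶜ = distᶜ id′ ⟪ lᶜ I , ⟪ structure-indexᶜ member-testᶜ (lᶜ I) , I ⟫ᶜ ⟫ᶜ
      where
      I : Comp ∅ (λ x → right (right x))
      I = rᶜ right′

    triple-test-≡ : ∀ i → triple-test (triple i) ≡ 0
    triple-test-≡ i = trans (cong (λ k → dist (triple i) (triple k)) (trans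
      (cong right (right-⟪⟫ (left i) ⟪ structure-index member-testᶜ (left i) , i ⟫))
      (right-⟪⟫ (structure-index member-testᶜ (left i)) i))) (dist-refl (triple i))

    Triple : Pred ℕ 0ℓ
    Triple x = ∃[ i ] x ≡ ⟪ ⌜ tuple-of i ⌝ , ⟪ structure-index member-testᶜ (left i) , i ⟫ ⟫

    triples-enumerated : EnumeratedBy ∅ (gödel (semidecide triple-testᶜ)) Triple
    triples-enumerated x = mk⇔ complete sound
      where
      complete : Triple x → ∃ (φ ∅ (gödel (semidecide triple-testᶜ)) x)
      complete (i , eq) = 0 , semidecide triple-testᶜ , refl ,
        semidecide-complete triple-testᶜ
          (subst (λ x → triple-test x ≡ 0) (sym (trans eq (triple-≡ i))) (triple-test-≡ i))
      sound : ∃ (φ ∅ (gödel (semidecide triple-testᶜ)) x) → Triple x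
      sound h = right (right x) ,
        trans (dist≡0 (semidecide-sound triple-testᶜ (proj₂ (φ-gödel h)))) (sym (triple-≡ (right (right x))))

    cl-index : ∀ i → IsIndex (structure-index member-testᶜ (left i)) (cl M (tuple-of i))
    cl-index i = is-index member-testᶜ (left i) (Gen M (tuple-of i)) (member-⇔ i)

  𝕂 : ComputableAge (ageOf M)
  𝕂 = record
    { tuple      = tuple-of
    ; struct     = λ i → cl M (tuple-of i)
    ; index      = λ i → structure-index member-testᶜ (left i)
    ; indexes    = cl-index
    ; member     = λ i → cl-member (tuple-of i)
    ; tuple⊆     = λ i → ListAll.tabulate gen
    ; generates  = λ i x∈ → gen (Gen⁻ x∈)
    ; complete   = λ { {B} (l , _ , iso) →
        ⟪ ⌜ l ⌝ , 0 ⟫ , subst (λ l → cl M l ≅ B) (sym (tuple-of-⟪⟫ l 0)) iso }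
    ; triples-ce = gödel (semidecide triple-testᶜ) , triples-enumerated
    }

  canonical : Canonical M 𝕂
  canonical = record
    { tuple⊆M         = λ i → all-M (tuple-of i)
    ; infinitelyOften = λ {l} _ n → ⟪ ⌜ l ⌝ , n ⟫ , n≤⟪m,n⟫ ⌜ l ⌝ n , tuple-of-⟪⟫ l n
    ; tuple-comp      = gödel (code (left′ {∅})) , λ n → code left′ , refl ,
        subst (Eval ∅ (code left′) n) (sym (⌜list⌝ (left n))) (correct left′ n)
    ; struct-cl       = λ i → record
        { dom-≐ = λ _ → mk⇔ id id ; rel-≐ = λ _ _ → mk⇔ id id ; fun-≐ = λ () }
    }

  -- The recursion prepends spine m at stage m, as `applyDownFrom` does. It runs for `suc (suc k)`
  -- stages because `below (suc k)` has k + 2 entries.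
  anchor-code : ℕ → ℕ
  anchor-code k = suc ⟪ point k , primrec (λ _ → 0) (λ s → suc ⟪ spine (left (right s)) , right (right s) ⟫) 0 (suc (suc k)) ⟫

  anchor-codeᶜ : ∀ {S f} → Comp S f → Comp S (λ n → anchor-code (f n))
  anchor-codeᶜ F = sucᶜ ⟪ pointᶜ ∘ᶜ F , primrecᶜ (const′ 0)
    (sucᶜ ⟪ spineᶜ ∘ᶜ lᶜ right′ , rᶜ right′ ⟫ᶜ) (const′ 0) (sucᶜ (sucᶜ F)) ⟫ᶜ

  anchor-code-≡ : ∀ k → anchor-code k ≡ ⌜ anchor k ⌝
  anchor-code-≡ k = cong (λ c → suc ⟪ point k , c ⟫) (lemma (suc (suc k)))
    where
    lemma : ∀ m → primrec (λ _ → 0) (λ s → suc ⟪ spine (left (right s)) , right (right s) ⟫) 0 m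
                  ≡ ⌜ applyDownFrom spine m ⌝
    lemma zero    = refl
    lemma (suc m) = let r = primrec (λ _ → 0) (λ s → suc ⟪ spine (left (right s)) , right (right s) ⟫) 0 m in
      trans (cong (λ p → suc ⟪ spine (left p) , right p ⟫) (right-⟪⟫ 0 ⟪ m , r ⟫))
        (cong₂ (λ x y → suc ⟪ spine x , y ⟫) (left-⟪⟫ m r) (trans (right-⟪⟫ m r) (lemma m)))

-- Deciding the halting problem

lower-em : ExcludedMiddle (lsuc 0ℓ) → ExcludedMiddle 0ℓ
lower-em em {P} = map-dec lower lift (em {Lift (lsuc 0ℓ) P})

-- `Eval` consults S as a predicate, the machine as a function; the function obtained here is
-- computed by `oracleᶜ` relative to S.
oracle-function : ExcludedMiddle 0ℓ → (S : Pred ℕ 0ℓ) → Σ[ χ ∈ (ℕ → ℕ) ] (∀ n → Eval S oracleᶜ n (χ n))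
oracle-function em S = (λ n → answer (em {n ∈ S})) , λ n → correct-answer (em {n ∈ S})
  where
  answer : ∀ {n} → Dec (n ∈ S) → ℕ
  answer (yes _) = 1
  answer (no _)  = 0
  correct-answer : ∀ {n} (d : Dec (n ∈ S)) → Eval S oracleᶜ n (answer d)
  correct-answer (yes n∈) = e-yes n∈
  correct-answer (no n∉)  = e-no n∉

open Graph att
open Indexing att attᶜ

source-index : ℕ → ℕ
source-index e = ⟪ anchor-code ⟪ e , 0 ⟫ , 0 ⟫

tuple-of-source : ∀ e → tuple-of (source-index e) ≡ anchor ⟪ e , 0 ⟫
tuple-of-source e = trans (cong (λ c → tuple-of ⟪ c , 0 ⟫) (anchor-code-≡ ⟪ e , 0 ⟫))
  (tuple-of-⟪⟫ (anchor ⟪ e , 0 ⟫) 0)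

-- If the code of the target tuple l were below t, then neither point n nor spine `suc n` could be
-- in l. The image of point k, being point k or point n, would be point k; so k would be in l, as
-- `not-base` requires.
base-bounds-time : ExcludedMiddle 0ℓ → ∀ {F e t} → IsEmbedding 𝕂 F → source F ≡ source-index e →
                   AmalgamationBase (ageOf M) (cl M (tuple-of (target F))) →
                   ExactTime e t → t ≤ ⌜ tuple-of (target F) ⌝
base-bounds-time em {F} {e} {t} (c⊆ , iso) i≡ base x = ≮⇒≥ absurd
  where
  k n : ℕ
  k = ⟪ e , 0 ⟫
  n = ⟪ e , t ⟫

  l : List ℕ
  l = tuple-of (target F)

  anchor-embeds : cl M (anchor k) , anchor k ≃ cl M l , image F
  anchor-embeds = subst (λ s → cl M s , s ≃ cl M l , image F)
    (trans (cong tuple-of i≡) (tuple-of-source e)) iso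

  n≢k : n ≢ k
  n≢k n≡k = ¬ExactTime-0 (subst (ExactTime e) (proj₂ (⟪⟫-injective e t e 0 n≡k)) x)

  absurd : ¬ (⌜ l ⌝ < t)
  absurd l<t = not-base em {l} {k} {n} (att-fixed e) (att-exact {e} {t} x) n≢k k∈l (large (n≤point n))
                 (large (≤-trans (n≤1+n n) (n≤spine (suc n)))) base
    where
    large : ∀ {y} → n ≤ y → ¬ (y ∈ˡ l)
    large n≤y y∈ = <-irrefl refl (<-trans (∈⇒<⌜⌝ y∈) (<-≤-trans l<t (≤-trans (n≤⟪m,n⟫ e t) n≤y)))

    preimage : ∀ {q} → q ≡ k ⊎ att q ≡ k → q ≡ k ⊎ q ≡ n
    preimage (inj₁ q≡k)  = inj₁ q≡k
    preimage (inj₂ aq≡k) = att-preimage {e} {t} x _ aq≡k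

    image-in-l : ∀ {q} → point q ∈ˡ l → q ≡ k ⊎ q ≡ n → point k ∈ˡ l
    image-in-l q∈l (inj₁ q≡k) = subst (λ q → point q ∈ˡ l) q≡k q∈l
    image-in-l q∈l (inj₂ q≡n) = ⊥-elim (large (n≤point n) (subst (λ q → point q ∈ˡ l) q≡n q∈l))

    k∈l : point k ∈ˡ l
    k∈l = let (q , q∈c , q-att) = anchor-image {k = k} anchor-embeds in
      image-in-l (Gen⁻ (ListAll.lookup c⊆ q∈c)) (preimage q-att)

opaque
  -- The number of an arrow is ⟪ ⟪ tuple , ⟪ index , source ⟫ ⟫ , ⟪ ⟪ tuple , _ ⟫ , image ⟫ ⟫.
  source-of target-tuple : ℕ → ℕ
  source-of x = right (right (left x))
  target-tuple x = left (left (right x))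

  source-of-arrow : ∀ a b i z → source-of ⟪ ⟪ a , ⟪ b , i ⟫ ⟫ , z ⟫ ≡ i
  source-of-arrow a b i z = trans (cong (λ k → right (right k)) (left-⟪⟫ ⟪ a , ⟪ b , i ⟫ ⟫ z))
    (trans (cong right (right-⟪⟫ a ⟪ b , i ⟫)) (right-⟪⟫ b i))

  target-tuple-arrow : ∀ z a b c → target-tuple ⟪ z , ⟪ ⟪ a , b ⟫ , c ⟫ ⟫ ≡ a
  target-tuple-arrow z a b c = trans (cong (λ k → left (left k)) (right-⟪⟫ z ⟪ ⟪ a , b ⟫ , c ⟫))
    (trans (cong left (left-⟪⟫ ⟪ a , b ⟫ c)) (left-⟪⟫ a b))

  -- The candidate y = ⟪ x , t ⟫ consists of an arrow number x and a halting time t.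
  found : (ℕ → ℕ) → ℕ → ℕ → ℕ → ℕ
  found χ p i y = running χ (right y) (enter p (left y)) + dist (source-of (left y)) i

  foundᶜ : ∀ {S χ f g} p → Comp S χ → Comp S f → Comp S g → Comp S (λ n → found χ p (f n) (g n))
  foundᶜ {χ = χ} p X F G = runningᶜ {χ = χ} X (rᶜ G) (enterᶜ (const′ p) (lᶜ G)) +ᶜ distᶜ (rᶜ (rᶜ (lᶜ (lᶜ G)))) F

  target-tupleᶜ : ∀ {S f} → Comp S f → Comp S (λ n → target-tuple (f n))
  target-tupleᶜ F = lᶜ (lᶜ (rᶜ F))

  found-complete : ∀ {P χ} → (∀ n → Eval P oracleᶜ n (χ n)) → ∀ {p i} x →
                   ∃ (φ P p x) → source-of x ≡ i → ∃[ y ] found χ p i y ≡ 0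
  found-complete {χ = χ} oracle x (_ , c , refl , e) refl with enter-complete oracle e
  ... | t , h = ⟪ x , t ⟫ , cong₂ _+_
    (trans (cong₂ (λ x t → running χ t (enter (gödel c) x)) (left-⟪⟫ x t) (right-⟪⟫ x t)) h)
    (trans (cong (λ x′ → dist (source-of x′) (source-of x)) (left-⟪⟫ x t)) (dist-refl (source-of x)))

  found-sound : ∀ {P χ} → (∀ n → Eval P oracleᶜ n (χ n)) → ∀ {i} c y → found χ (gödel c) i y ≡ 0 →
                ∃ (φ P (gödel c) (left y)) × source-of (left y) ≡ i
  found-sound {χ = χ} oracle c y eq =
    (let (m , e) = enter-sound oracle (right y) c (left y) (m+n≡0⇒m≡0 _ eq) in m , c , refl , e) ,
    dist≡0 (m+n≡0⇒n≡0 (running χ (right y) (enter (gödel c) (left y))) eq)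

source-of-⌜⌝ᵃ : ∀ F → source-of (⌜_⌝ᵃ 𝕂 F) ≡ source F
source-of-⌜⌝ᵃ (arrow i j c) = source-of-arrow ⌜ tuple-of i ⌝ (index i) i ⟪ ⌜𝕀⌝ j , ⌜ c ⌝ ⟫
  where open ComputableAge 𝕂

target-tuple-⌜⌝ᵃ : ∀ F → target-tuple (⌜_⌝ᵃ 𝕂 F) ≡ ⌜ tuple-of (target F) ⌝
target-tuple-⌜⌝ᵃ (arrow i j c) = target-tuple-arrow (⌜𝕀⌝ i) ⌜ tuple-of j ⌝ ⟪ index j , j ⟫ ⌜ c ⌝
  where open ComputableAge 𝕂

module _ (em : ExcludedMiddle 0ℓ) {S : Pred ℕ 0ℓ} (w : CAPWitness 𝕂) where
  open CAPWitness w
  open DistinguishedExtensions distinguished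

  module _ (p : ℕ) (enum : EnumeratedBy S p (λ x → ∃[ F ] F ∈ AB × x ≡ ⌜_⌝ᵃ 𝕂 F)) where

    private
      χ : ℕ → ℕ
      χ = proj₁ (oracle-function em S)

      oracle : ∀ n → Eval S oracleᶜ n (χ n)
      oracle = proj₂ (oracle-function em S)

      bound : ℕ → ℕ
      bound y = target-tuple (left y)

      enumerate : ∀ {F} → F ∈ AB → ∃ (φ S p (⌜_⌝ᵃ 𝕂 F))
      enumerate {F} F∈ = to (enum (⌜_⌝ᵃ 𝕂 F)) (F , F∈ , refl)

      -- A member of AB makes p halt somewhere, so p is the number of a program and `enter` may run
      -- it without a check.
      program-of-p : ∃[ c ] gödel c ≡ p
      program-of-p =
        let (_ , F∈ , _) = cofinal 0
            (_ , c , eq , _) = enumerate F∈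
        in c , eq

      exists-found : ∀ e → ∃[ y ] found χ p (source-index e) y ≡ 0
      exists-found e = let (F , F∈ , eq) = cofinal (source-index e) in
        found-complete oracle (⌜_⌝ᵃ 𝕂 F) (enumerate F∈) (trans (source-of-⌜⌝ᵃ F) eq)

      found-in-AB : ∀ i y → found χ p i y ≡ 0 →
                    ∃[ F ] F ∈ AB × left y ≡ ⌜_⌝ᵃ 𝕂 F × source F ≡ i
      found-in-AB i y eq =
        let (c , c≡p) = program-of-p
            (h , src) = found-sound oracle c y (subst (λ p → found χ p i y ≡ 0) (sym c≡p) eq)
            (F , F∈ , x≡) = from (enum (left y)) (subst (λ p → ∃ (φ S p (left y))) c≡p h)
        in F , F∈ , x≡ , trans (sym (source-of-⌜⌝ᵃ F)) (trans (cong source-of (sym x≡)) src)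

      -- Every base above the anchor bounds the halting time, so it does not matter which
      -- distinguished extension the search finds.
      bound-suffices : ∀ e y → found χ p (source-index e) y ≡ 0 → e ∈ ∅′ → T e (bound y) ≡ 0
      bound-suffices e y eq e∈ =
        let (F , F∈ , x≡ , src) = found-in-AB (source-index e) y eq
            (t , x) = exact-time e∈
            t≤ = base-bounds-time em {F} {e} {t} (embeddings F∈) src (bases F∈) x
        in T-mono e t (bound y)
             (≤-trans t≤ (≤-reflexive (sym (trans (cong target-tuple x≡) (target-tuple-⌜⌝ᵃ F))))) (proj₁ x)

      test : ℕ → ℕ
      test s = found χ p (source-index (left s)) (right s)

      testᶜ : Comp S test
      testᶜ = foundᶜ p (comp oracleᶜ oracle)
        ⟪ anchor-codeᶜ ⟪ left′ , const′ 0 ⟫ᶜ , const′ 0 ⟫ᶜ right′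

      verdict : ℕ → ℕ → ℕ
      verdict e y = ifz (T e (bound y)) 1 0

      verdictᶜ : Comp S (λ s → verdict (left s) (right s))
      verdictᶜ = ifzᶜ (Tᶜ left′ (target-tupleᶜ (lᶜ right′))) (const′ 1) (const′ 0)

      decision : Code
      decision = compᶜ (code verdictᶜ) (pairᶜ (code (id′ {S})) (search testᶜ))

      outcome : ∀ e → ∃[ y ] Eval S decision e (verdict e y) × (e ∈ ∅′ → T e (bound y) ≡ 0)
      outcome e =
        let (y₀ , eq₀) = exists-found e
            (y , r , eq) = search-correct testᶜ e y₀ (trans (apply₂ f e y₀) eq₀)
        in y ,
           e-comp (e-pair (correct id′ e) r)
             (subst (Eval S (code verdictᶜ) ⟪ e , y ⟫) (apply₂ verdict e y) (correct verdictᶜ ⟪ e , y ⟫)) ,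
           bound-suffices e y (trans (sym (apply₂ f e y)) eq)
        where
        f : ℕ → ℕ → ℕ
        f e y = found χ p (source-index e) y

    -- The answer 1 is right under any bound, by soundness of `T`; the answer 0 is right because the
    -- bound found is large enough.
    ∅′-decided : DecidedBy S (gödel decision) ∅′
    ∅′-decided e = let (y , r , sound) = outcome e in
      (λ e∈ → decision , refl , subst (Eval S decision e) (ifz-zero (sound e∈)) r) ,
      (λ e∉ → decision , refl , subst (Eval S decision e)
                (from not≡0 (e∉ ∘ T-sound e (bound y))) r)

theorem7p1 : ExcludedMiddle (lsuc 0ℓ) →
    Σ[ L ∈ Language ] FiniteRelational L ×
    (Σ[ M ∈ Structure L ] ComputableStructure M ×
    (Σ[ 𝕂 ∈ ComputableAge (ageOf M) ] Canonical M 𝕂 ×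
    CAP (ageOf M) ×
    ((𝔰 : Pred ℕ 0ℓ) → cCAP 𝕂 𝔰 → ∅′ ≤ᵀ 𝔰)))
theorem7p1 em =
  digraph , ((0 ∷ [] , λ { refl → here refl }) , λ ()) ,
  M , M-computable , 𝕂 , canonical ,
  cap em₀ att≤ (att-finite-to-one em₀) ,
  λ 𝔰 (w , (p , enum) , _) → _ , ∅′-decided em₀ w p enum
  where
  em₀ : ExcludedMiddle 0ℓ
  em₀ = lower-em em
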